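{- For every field $\mathbb{F}$, there exists a (polynomial-time) kernelization algorithm for the Dual Minrank$_{\mathbb{F}}$ problem, which given an instance $(G,k)$ (a graph $G$ and an integer $k \geq 0$) returns an equivalent instance $(G',k')$, where $G'$ has at most $\max(3k'-3,0)$ vertices and $k' \leq k$. Here equivalence means that $\mathrm{minrk}_{\mathbb{F}}(G) \leq n-k$ if and only if $\mathrm{minrk}_{\mathbb{F}}(G') \leq n'-k'$, where $n$ and $n'$ are the numbers of vertices of $G$ and $G'$ respectively.
   Context: All graphs are finite, undirected and simple; the graph $K_0$ with no vertices and no edges is allowed. $[n]=\{1,\dots,n\}$. Minrank: let $G$ be a graph on the vertex set $[n]$ and let $\mathbb{F}$ be a field. A matrix $A \in \mathbb{F}^{n \times n}$ represents $G$ over $\mathbb{F}$ if $A_{i,i} \neq 0$ for every $i \in [n]$, and $A_{i,j}=0$ for every pair $i,j \in [n]$ of distinct vertices that are not adjacent in $G$ ($A$ need not be symmetric). Then $\mathrm{minrk}_{\mathbb{F}}(G) = \min\{\mathrm{rank}_{\mathbb{F}}(A) \mid A \text{ represents } G \text{ over } \mathbb{F}\}$. For a graph on an arbitrary $n$-element vertex set, identify the vertex set with $[n]$; in particular $\mathrm{minrk}_{\mathbb{F}}(K_0)=0$. The Dual Minrank$_{\mathbb{F}}$ problem: given a graph $G$ on $n$ vertices and an integer $k \geq 0$, decide whether $\mathrm{minrk}_{\mathbb{F}}(G) \leq n-k$; the parameter is $k$. A kernelization algorithm for a parameterized problem $L$ is an algorithm that, given an instance $(x,k)$, runs in polynomial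 time and returns an instance $(x',k')$ with $|x'|,k' \leq h(k)$ for some computable function $h:\mathbb{N}\to\mathbb{N}$, such that $(x,k) \in L$ if and only if $(x',k') \in L$ (the instances are then called equivalent). -}

module Defs where

open import Algebra.Bundles using (CommutativeRing)
open import Data.Bool.Base using (Bool; true; false; T)
open import Data.Fin.Base using (Fin)
open import Data.Integer.Base as ℤ using (+_)
open import Data.List.Base using (List; []; _∷_; map; tabulate)
open import Data.Nat.Base as ℕ using (ℕ; zero; suc; _+_; _^_; _≤_)
open import Data.Product.Base using (Σ-syntax; ∃-syntax; _×_; _,_; proj₁; proj₂)
open import Data.Vec.Base using (Vec; []; _∷_; lookup)
open import Function.Bundles using (_⇔_)
open import Level using (Level; _⊔_) renaming (zero to 0ℓ; suc to lsuc)
open import Relation.Binary.PropositionalEquality.Core using (_≡_; _≢_)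
open import Relation.Nullary.Negation.Core using (¬_)
import Algebra.Properties.Semiring.Sum as Sum

------------------------------------------------------------------------
-- Computation

data Tree : Set where
  leaf : Tree
  node : Tree → Tree → Tree

size : Tree → ℕ
size leaf       = 1
size (node a b) = suc (size a + size b)

-- The model of computation is a first-order, call-by-value functional
-- language with general recursion over binary trees (the data type of
-- Jones's WHILE language).  Every rule costs one step.  Values can be
-- shared, so for a fixed program each step takes constant time on a pointer
-- machine; conversely a tree represents a list of symbols, hence a tape, and
-- a Turing machine is simulated with constant overhead per step.  Time is
-- therefore polynomially related to Turing-machine time.
--
-- `Exp arity n` : expressions with n free (de Bruijn) variables that may call
-- m globally defined, mutually recursive functions of the given arities.

data Exp {m : ℕ} (arity : Fin m → ℕ) (n : ℕ) : Set where
  var  : Fin n → Exp arity n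
  nil  : Exp arity n
  cons : Exp arity n → Exp arity n → Exp arity n
  case : Exp arity n → Exp arity n → Exp arity (2 + n) → Exp arity n
  bind : Exp arity n → Exp arity (1 + n) → Exp arity n
  call : (f : Fin m) → Vec (Exp arity n) (arity f) → Exp arity n

record Program : Set where
  field
    functions : ℕ
    arity     : Fin functions → ℕ
    body      : (f : Fin functions) → Exp arity (arity f)
    main      : Exp arity 1

module Semantics (p : Program) where
  open Program p

  infix 4 _⊢_⇓_⟨_⟩ _⊢*_⇓_⟨_⟩

  -- ρ ⊢ e ⇓ v ⟨ t ⟩ : in environment ρ, e evaluates to v in t steps.
  data _⊢_⇓_⟨_⟩ {n : ℕ} (ρ : Vec Tree n) : Exp arity n → Tree → ℕ → Set

  data _⊢*_⇓_⟨_⟩ {n : ℕ} (ρ : Vec Tree n) :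
         {k : ℕ} → Vec (Exp arity n) k → Vec Tree k → ℕ → Set

  data _⊢_⇓_⟨_⟩ {n} ρ where
    ⇓var  : ∀ {x} → ρ ⊢ var x ⇓ lookup ρ x ⟨ 1 ⟩
    ⇓nil  : ρ ⊢ nil ⇓ leaf ⟨ 1 ⟩
    ⇓cons : ∀ {e₁ e₂ v₁ v₂ s t} →
            ρ ⊢ e₁ ⇓ v₁ ⟨ s ⟩ → ρ ⊢ e₂ ⇓ v₂ ⟨ t ⟩ →
            ρ ⊢ cons e₁ e₂ ⇓ node v₁ v₂ ⟨ suc (s + t) ⟩
    ⇓leaf : ∀ {e e₁ e₂ v s t} →
            ρ ⊢ e ⇓ leaf ⟨ s ⟩ → ρ ⊢ e₁ ⇓ v ⟨ t ⟩ →
            ρ ⊢ case e e₁ e₂ ⇓ v ⟨ suc (s + t) ⟩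
    ⇓node : ∀ {e e₁ e₂ a b v s t} →
            ρ ⊢ e ⇓ node a b ⟨ s ⟩ → a ∷ b ∷ ρ ⊢ e₂ ⇓ v ⟨ t ⟩ →
            ρ ⊢ case e e₁ e₂ ⇓ v ⟨ suc (s + t) ⟩
    ⇓bind : ∀ {e₁ e₂ u v s t} →
            ρ ⊢ e₁ ⇓ u ⟨ s ⟩ → u ∷ ρ ⊢ e₂ ⇓ v ⟨ t ⟩ →
            ρ ⊢ bind e₁ e₂ ⇓ v ⟨ suc (s + t) ⟩
    ⇓call : ∀ {f es vs v s t} →
            ρ ⊢* es ⇓ vs ⟨ s ⟩ → vs ⊢ body f ⇓ v ⟨ t ⟩ →
            ρ ⊢ call f es ⇓ v ⟨ suc (s + t) ⟩

  data _⊢*_⇓_⟨_⟩ {n} ρ where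
    ⇓[] : ρ ⊢* [] ⇓ [] ⟨ 0 ⟩
    ⇓∷  : ∀ {k e v s t} {es : Vec (Exp arity n) k} {vs : Vec Tree k} →
          ρ ⊢ e ⇓ v ⟨ s ⟩ → ρ ⊢* es ⇓ vs ⟨ t ⟩ →
          ρ ⊢* (e ∷ es) ⇓ (v ∷ vs) ⟨ s + t ⟩

Runs : Program → (input output : Tree) (steps : ℕ) → Set
Runs p x y t = (x ∷ []) ⊢ Program.main p ⇓ y ⟨ t ⟩
  where open Semantics p

⟦_⟧ℕ : ℕ → Tree
⟦ zero  ⟧ℕ = leaf
⟦ suc n ⟧ℕ = node leaf ⟦ n ⟧ℕ

⟦_⟧Bool : Bool → Tree
⟦ false ⟧Bool = leaf
⟦ true  ⟧Bool = node leaf leaf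

⟦_⟧List : List Tree → Tree
⟦ []     ⟧List = leaf
⟦ x ∷ xs ⟧List = node x ⟦ xs ⟧List

Computable : (ℕ → ℕ) → Set
Computable h = ∃[ p ] ∀ n → ∃[ t ] Runs p ⟦ n ⟧ℕ ⟦ h n ⟧ℕ t

------------------------------------------------------------------------
-- Parameterized problems and kernelization

record ParameterizedProblem (a ℓ : Level) : Set (lsuc (a ⊔ ℓ)) where
  field
    Instance : Set a
    encode   : Instance → Tree
    Yes      : Instance → ℕ → Set ℓ

module _ {a ℓ : Level} (L : ParameterizedProblem a ℓ) where
  open ParameterizedProblem L

  -- The parameter is written in unary, following the usual convention that
  -- the size of an instance (x , k) is |x| + k.
  ⟦_⟧Instance : Instance × ℕ → Tree
  ⟦ x , k ⟧Instance = node (encode x) ⟦ k ⟧ℕ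

  -- Because of sharing, a large output tree may be built in few steps; the
  -- time to write the output down in full is therefore charged as well.
  PolynomialTime : (Instance × ℕ → Instance × ℕ) → Set a
  PolynomialTime f =
    ∃[ p ] ∃[ c ] ∃[ d ] ∀ x k →
      ∃[ t ] Runs p ⟦ x , k ⟧Instance ⟦ f (x , k) ⟧Instance t
           × t + size ⟦ f (x , k) ⟧Instance ≤ c ℕ.* (size (encode x) + k) ^ d + c

  record Kernelization : Set (a ⊔ ℓ) where
    field
      kernel         : Instance × ℕ → Instance × ℕ
      polynomialTime : PolynomialTime kernel
      bound          : ℕ → ℕ
      computable     : Computable bound
      bounded        : ∀ x k → let (x′ , k′) = kernel (x , k) in
                       size (encode x′) ≤ bound k × k′ ≤ bound k
      equivalent     : ∀ x k → let (x′ , k′) = kernel (x , k) in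
                       Yes x k ⇔ Yes x′ k′

------------------------------------------------------------------------
-- Graphs

record Graph : Set where
  field
    order  : ℕ
    adj    : Fin order → Fin order → Bool
    sym    : ∀ i j → adj i j ≡ adj j i
    irrefl : ∀ i → adj i i ≡ false

  Vertex : Set
  Vertex = Fin order

  Adjacent : Vertex → Vertex → Set
  Adjacent i j = T (adj i j)

open Graph public using (order)

⟦_⟧Graph : Graph → Tree
⟦ G ⟧Graph = ⟦ tabulate (λ i → ⟦ tabulate (λ j → ⟦ adj i j ⟧Bool) ⟧List) ⟧List
  where open Graph G

------------------------------------------------------------------------
-- Fields, rank and minrank

record Field (c ℓ : Level) : Set (lsuc (c ⊔ ℓ)) where
  field
    commutativeRing : CommutativeRing c ℓ
  open CommutativeRing commutativeRing public
  field
    0≉1     : ¬ 0# ≈ 1#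
    inverse : ∀ x → ¬ x ≈ 0# → ∃[ y ] x * y ≈ 1#

IsMinimum IsMaximum : ∀ {ℓ} → (ℕ → Set ℓ) → ℕ → Set ℓ
IsMinimum P r = P r × (∀ s → P s → r ≤ s)
IsMaximum P r = P r × (∀ s → P s → s ≤ r)

module _ {c ℓ : Level} (F : Field c ℓ) where
  private module F = Field F
  open F using (Carrier; _≈_; 0#)
  open Sum F.semiring using (sum)

  Matrix : ℕ → ℕ → Set c
  Matrix m n = Fin m → Fin n → Carrier

  LinearlyIndependent : ∀ {m r} → (Fin r → Fin m → Carrier) → Set (c ⊔ ℓ)
  LinearlyIndependent {m} {r} v =
    ∀ (a : Fin r → Carrier) →
    (∀ i → sum (λ j → a j F.* v j i) ≈ 0#) → ∀ j → a j ≈ 0#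

  -- A selection of columns with a repetition is never independent, so the
  -- index function below need not be required to be injective.
  HasIndependentColumns : ∀ {m n} → Matrix m n → ℕ → Set (c ⊔ ℓ)
  HasIndependentColumns {m} {n} A r =
    Σ[ col ∈ (Fin r → Fin n) ] LinearlyIndependent (λ j i → A i (col j))

  IsRank : ∀ {m n} → Matrix m n → ℕ → Set (c ⊔ ℓ)
  IsRank A = IsMaximum (HasIndependentColumns A)

  Represents : (G : Graph) → Matrix (order G) (order G) → Set ℓ
  Represents G A =
    (∀ i → ¬ A i i ≈ 0#) ×
    (∀ i j → i ≢ j → ¬ Adjacent i j → A i j ≈ 0#)
    where open Graph G

  IsMinrank : Graph → ℕ → Set (c ⊔ ℓ)
  IsMinrank G = IsMinimum (λ r → ∃[ A ] Represents G A × IsRank A r)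

  -- The minimum and the rank are unique when they exist, and with excluded
  -- middle they always exist; `n - k` is an integer and may be negative.
  DualMinrank : ParameterizedProblem 0ℓ (c ⊔ ℓ)
  DualMinrank = record
    { Instance = Graph
    ; encode   = ⟦_⟧Graph
    ; Yes      = λ G k → ∃[ r ] IsMinrank G r × + r ℤ.≤ + order G ℤ.- + k
    }

{-# OPTIONS --safe #-}
module Submission where

-- For a graph restricted to a vertex set S call k a saving if the minrank is at
-- most ∣ S ∣ - k.  Two facts suffice: adding a clique to S raises the minrank by
-- at most one (take an all-one block), and adding an isolated vertex raises it
-- by exactly one.  Hence a matching of size k saves k, and if C is independent
-- and its neighbourhood H is matched into C (a crown), then C ∪ H can be deleted
-- at the price of lowering k by ∣ H ∣.
--
-- Let I be the independent set left by a greedy maximal matching.  Cover the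
-- vertices of I one by one, by augmenting paths in the bipartite graph between I
-- and the rest.  The first search that fails exhibits a crown, which is deleted,
-- and everything starts afresh.  If no search fails, then I is covered by a
-- matching.  So either one of the two matchings has size at least k and the
-- answer is yes, or at most (k - 1) + 2 (k - 1) vertices are left.
--
-- The algorithm is a term of a small typed language whose loops run over the
-- vertices only.  Every nesting of such loops takes polynomial time whatever
-- values are computed, as values are shared.

-- The problem speaks of exact ranks and minima, whose existence over an arbitrary field is not
-- constructive. The combinatorics is therefore done with upper bounds alone: a representing matrix
-- together with a bound on the number of its independent columns. Excluded middle enters only when
-- such a bound is compared with the problem itself. A crown must be removed by an equivalence. One
-- direction rebuilds it: every matched edge between H and C adds two vertices for one unit of rank.
-- In the other direction, deleting H does not raise the minrank and so loses at most ∣ H ∣ of the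
-- saving; it leaves the vertices of C isolated, and here it matters that an isolated vertex costs
-- exactly one. What a failed search reaches lies in I and so is independent; it is closed under
-- alternating paths, which says that all its neighbours are matched into it. Deletions only clear
-- bits of a mask, so the numbering of the vertices and the loop bounds stay fixed until the
-- remaining graph is written out.

open import Defs
open import Axiom.ExcludedMiddle using (ExcludedMiddle)
open import Axiom.UniquenessOfIdentityProofs.WithK using (uip)
open import Data.Bool.Base using (Bool; true; false; if_then_else_; T)
open import Data.Bool.Properties as Bool using (if-float)
open import Data.Empty using (⊥-elim)
open import Data.Fin.Base using (Fin; zero; suc; _↑ˡ_; _↑ʳ_; splitAt; toℕ; inject₁; fromℕ; punchIn; punchOut)
open import Data.Fin.Patterns using (0F; 1F; 2F; 3F; 4F; 5F; 6F; 7F; 8F; 9F)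
open import Data.Fin.Properties using (splitAt-↑ˡ; splitAt-↑ʳ; _≟_; toℕ-inject₁; toℕ-fromℕ; toℕ<n; toℕ-injective; any?; injective⇒≤; punchIn-punchOut)
open import Data.Integer.Base as ℤ using (+_)
open import Data.List.Base as List using (List; []; _∷_; length; tabulate; allFin; filterᵇ)
open import Data.List.Membership.Propositional.Properties using (∈-filter⁺; ∈-filter⁻; ∈-allFin; ∈-lookup)
open import Data.List.Properties using (length-tabulate; map-tabulate; tabulate-lookup; map-∘; map-cong)
open import Data.List.Relation.Unary.All as All using (All; []; _∷_)
open import Data.List.Relation.Unary.AllPairs.Core using (_∷_)
open import Data.List.Relation.Unary.Any as Any using ()
open import Data.List.Relation.Unary.Any.Properties using (lookup-index)
open import Data.Maybe.Base using (Maybe; just; nothing; maybe′)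
open import Data.Maybe.Properties using (just-injective)
open import Data.Nat.Base using (ℕ; zero; suc; _+_; _*_; _^_; _≤_; z≤n; s≤s; pred; _∸_; _<_; >-nonZero; s≤s⁻¹)
open import Data.Nat.Induction using (<-rec)
open import Data.Nat.Properties hiding (_≟_)
open import Data.Nat.Tactic.RingSolver using (solve-∀)
open import Data.Product.Base using (∃-syntax; _×_; _,_; proj₁; proj₂; Σ-syntax)
open import Data.Sum.Base using ([_,_]′; _⊎_; inj₁; inj₂)
open import Data.Unit.Base using (⊤; tt)
open import Data.Vec.Base using (Vec; []; _∷_; lookup)
open import Data.Vec.Functional using (insertAt)
open import Data.Vec.Functional.Properties using (insertAt-lookup; insertAt-punchIn)
open import Function.Base using (_∘_; id; case_of_)
open import Function.Bundles using (_⇔_; mk⇔; Equivalence)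
open import Function.Properties.Equivalence using () renaming (trans to ⇔-trans; sym to ⇔-sym; refl to ⇔-refl)
open import Level using (_⊔_)
open import Relation.Binary.PropositionalEquality
open import Relation.Nullary.Decidable using (T?; dec-yes-irr)
open import Relation.Nullary.Decidable.Core using (Dec; does; yes; no; _×-dec_)
open import Relation.Nullary.Negation.Core using (¬_)
import Algebra.Properties.Ring as RingProperties
import Algebra.Properties.Semiring.Sum as Sum
import Data.Integer.Properties as ℤ
import Data.List.Relation.Unary.Unique.Propositional as Unique
import Data.List.Relation.Unary.Unique.Propositional.Properties as Unique
import Relation.Binary.Reasoning.Setoid as SetoidReasoning

-- A tree language with fuelled loops

left right : Tree → Tree
left  leaf       = leaf
left  (node a b) = a
right leaf       = leaf
right (node a b) = b

spine : Tree → ℕ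
spine leaf       = 0
spine (node a b) = suc (spine b)

-- Point-free tree functions.  A loop runs along the spine of its counter, but
-- never for more than a globally fixed number of rounds, the fuel; so its
-- running time is polynomial in the fuel whatever the values are.  The body
-- of a loop is applied to the rest of the counter, the accumulator and the
-- input.
data Code : Set where
  input nil : Code
  pair comp : Code → Code → Code
  hd tl     : Code → Code
  ifLeaf    : Code → Code → Code → Code
  loop      : (counter start body : Code) → Code

iterate : ℕ → Tree → (Tree → Tree → Tree) → Tree → Tree
iterate zero    c          f a = a
iterate (suc n) leaf       f a = a
iterate (suc n) (node _ c) f a = iterate n c f (f c a)

branch : ∀ {a} {A : Set a} → Tree → A → A → A
branch leaf       x y = x
branch (node _ _) x y = y

run : ℕ → Code → Tree → Tree
run n input          x = x
run n nil            x = leaf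
run n (pair c d)     x = node (run n c x) (run n d x)
run n (comp c d)     x = run n d (run n c x)
run n (hd c)         x = left (run n c x)
run n (tl c)         x = right (run n c x)
run n (ifLeaf c d e) x = branch (run n c x) (run n d x) (run n e x)
run n (loop c d e)   x =
  iterate n (run n c x) (λ i a → run n e (node i (node a x))) (run n d x)

-- The constants are the exact step counts of `loopBody`: 3 when the fuel is exhausted, 5 when the
-- counter is, and otherwise two case distinctions, a call, its arguments and the construction of
-- the body's input.
iterateCost : ℕ → Tree → (Tree → Tree → Tree) → (Tree → Tree → ℕ) → Tree → ℕ
iterateCost zero    c          f g a = 3
iterateCost (suc n) leaf       f g a = 5
iterateCost (suc n) (node _ c) f g a =
  5 + (2 + (6 + g c a + 2) + iterateCost n c f g (f c a))

cost : ℕ → Code → Tree → ℕ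
cost n input          x = 1
cost n nil            x = 1
cost n (pair c d)     x = suc (cost n c x + cost n d x)
cost n (comp c d)     x = suc (cost n c x + cost n d (run n c x))
cost n (hd c)         x = suc (cost n c x + 1)
cost n (tl c)         x = suc (cost n c x + 1)
cost n (ifLeaf c d e) x = suc (cost n c x + branch (run n c x) (cost n d x) (cost n e x))
cost n (loop c d e)   x = suc (1 + (cost n c x + (cost n d x + 2)) +
  iterateCost n (run n c x) (λ i a → run n e (node i (node a x)))
                            (λ i a → cost n e (node i (node a x))) (run n d x))

-- The machine recurses only through globally defined functions, so every loop of a code becomes a
-- function of its own.
loops : Code → ℕ
loops input          = 0
loops nil            = 0
loops (pair c d)     = loops c + loops d
loops (comp c d)     = loops c + loops d
loops (hd c)         = loops c
loops (tl c)         = loops c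
loops (ifLeaf c d e) = loops c + (loops d + loops e)
loops (loop c d e)   = suc (loops c + (loops d + loops e))

module _ {m : ℕ} where

  private
    Expr : ℕ → Set
    Expr = Exp {m} (λ _ → 5)

  -- The variables `f` and `x` hold the fuel and the input.
  compile : ∀ {q} (c : Code) → (Fin (loops c) → Fin m) → (f x : Fin q) → Expr q
  compile input          ι f x = var x
  compile nil            ι f x = nil
  compile (pair c d)     ι f x =
    cons (compile c (ι ∘ (_↑ˡ loops d)) f x) (compile d (ι ∘ (loops c ↑ʳ_)) f x)
  compile (comp c d)     ι f x =
    bind (compile c (ι ∘ (_↑ˡ loops d)) f x) (compile d (ι ∘ (loops c ↑ʳ_)) (suc f) 0F)
  compile (hd c)         ι f x = case (compile c ι f x) nil (var 0F)
  compile (tl c)         ι f x = case (compile c ι f x) nil (var 1F)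
  compile (ifLeaf c d e) ι f x =
    case (compile c (ι ∘ (_↑ˡ (loops d + loops e))) f x)
         (compile d (ι ∘ (loops c ↑ʳ_) ∘ (_↑ˡ loops e)) f x)
         (compile e (ι ∘ (loops c ↑ʳ_) ∘ (loops d ↑ʳ_)) (suc (suc f)) (suc (suc x)))
  compile (loop c d e)   ι f x =
    call (ι 0F) ( var f
                ∷ compile c (ι ∘ suc ∘ (_↑ˡ (loops d + loops e))) f x
                ∷ compile d (ι ∘ suc ∘ (loops c ↑ʳ_) ∘ (_↑ˡ loops e)) f x
                ∷ var x ∷ var f ∷ [])

  -- The arguments are the remaining fuel, the counter, the accumulator, the
  -- input and the full fuel.
  loopBody : (e : Code) → (Fin (loops e) → Fin m) → Fin m → Expr 5
  loopBody e ι self =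
    case (var 0F) (var 2F)
      (case (var 3F) (var 4F)
        (call self ( var 3F ∷ var 1F
                   ∷ bind (cons (var 1F) (cons (var 6F) (var 7F))) (compile e ι 9F 0F)
                   ∷ var 7F ∷ var 8F ∷ [])))

  -- `ι` sends the loops of a subcode to their places in the table of the whole program, so that
  -- nested bodies call the right functions.
  bodies : (c : Code) → (Fin (loops c) → Fin m) → Fin (loops c) → Expr 5
  bodies (pair c d)     ι = [ bodies c (ι ∘ (_↑ˡ loops d))
                            , bodies d (ι ∘ (loops c ↑ʳ_)) ]′ ∘ splitAt (loops c)
  bodies (comp c d)     ι = [ bodies c (ι ∘ (_↑ˡ loops d))
                            , bodies d (ι ∘ (loops c ↑ʳ_)) ]′ ∘ splitAt (loops c)
  bodies (hd c)         ι = bodies c ι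
  bodies (tl c)         ι = bodies c ι
  bodies (ifLeaf c d e) ι =
    [ bodies c (ι ∘ (_↑ˡ (loops d + loops e)))
    , [ bodies d (ι ∘ (loops c ↑ʳ_) ∘ (_↑ˡ loops e))
      , bodies e (ι ∘ (loops c ↑ʳ_) ∘ (loops d ↑ʳ_)) ]′ ∘ splitAt (loops d) ]′
    ∘ splitAt (loops c)
  bodies (loop c d e)   ι zero    =
    loopBody e (ι ∘ suc ∘ (loops c ↑ʳ_) ∘ (loops d ↑ʳ_)) (ι 0F)
  bodies (loop c d e)   ι (suc i) =
    ([ bodies c (ι ∘ suc ∘ (_↑ˡ (loops d + loops e)))
     , [ bodies d (ι ∘ suc ∘ (loops c ↑ʳ_) ∘ (_↑ˡ loops e))
       , bodies e (ι ∘ suc ∘ (loops c ↑ʳ_) ∘ (loops d ↑ʳ_)) ]′ ∘ splitAt (loops d) ]′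
     ∘ splitAt (loops c)) i

module Soundness {m : ℕ} (B : Fin m → Exp {m} (λ _ → 5) 5) (main : Exp {m} (λ _ → 5) 1) where

  program : Program
  program = record { functions = m ; arity = λ _ → 5 ; body = B ; main = main }

  open Semantics program

  private
    onˡ : ∀ {a b} {X : Set} {γ : Fin (a + b) → X}
          {f : Fin a → X} {g : Fin b → X} →
          (∀ i → γ i ≡ [ f , g ]′ (splitAt a i)) → ∀ i → γ (i ↑ˡ b) ≡ f i
    onˡ {a} {b} {f = f} {g} h i =
      trans (h (i ↑ˡ b)) (cong [ f , g ]′ (splitAt-↑ˡ a i b))

    onʳ : ∀ {a b} {X : Set} {γ : Fin (a + b) → X}
          {f : Fin a → X} {g : Fin b → X} →
          (∀ i → γ i ≡ [ f , g ]′ (splitAt a i)) → ∀ i → γ (a ↑ʳ i) ≡ g i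
    onʳ {a} {b} {f = f} {g} h i =
      trans (h (a ↑ʳ i)) (cong [ f , g ]′ (splitAt-↑ʳ a b i))

  left⇓ : ∀ {q} {ρ : Vec Tree q} {e v s} → ρ ⊢ e ⇓ v ⟨ s ⟩ →
          ρ ⊢ case e nil (var 0F) ⇓ left v ⟨ suc (s + 1) ⟩
  left⇓ {v = leaf}     p = ⇓leaf p ⇓nil
  left⇓ {v = node _ _} p = ⇓node p ⇓var

  right⇓ : ∀ {q} {ρ : Vec Tree q} {e v s} → ρ ⊢ e ⇓ v ⟨ s ⟩ →
           ρ ⊢ case e nil (var 1F) ⇓ right v ⟨ suc (s + 1) ⟩
  right⇓ {v = leaf}     p = ⇓leaf p ⇓nil
  right⇓ {v = node _ _} p = ⇓node p ⇓var

  branch⇓ : ∀ {q} {ρ : Vec Tree q} {e e₁ e₂ v v₁ v₂ s s₁ s₂} → ρ ⊢ e ⇓ v ⟨ s ⟩ →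
            ρ ⊢ e₁ ⇓ v₁ ⟨ s₁ ⟩ → (∀ {a b} → a ∷ b ∷ ρ ⊢ e₂ ⇓ v₂ ⟨ s₂ ⟩) →
            ρ ⊢ case e e₁ e₂ ⇓ branch v v₁ v₂ ⟨ suc (s + branch v s₁ s₂) ⟩
  branch⇓ {v = leaf}     p p₁ p₂ = ⇓leaf p p₁
  branch⇓ {v = node _ _} p p₁ p₂ = ⇓node p p₂

  Implements : (c : Code) → (Fin (loops c) → Fin m) → Set
  Implements c ι = ∀ {q} (ρ : Vec Tree q) f x → let n = spine (lookup ρ f) ; t = lookup ρ x in
    ρ ⊢ compile c ι f x ⇓ run n c t ⟨ cost n c t ⟩

  loopBody⇓ : ∀ e ι self → B self ≡ loopBody e ι self → Implements e ι →
              ∀ φ k a x f → let n = spine f in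
              φ ∷ k ∷ a ∷ x ∷ f ∷ [] ⊢ loopBody e ι self
                ⇓ iterate (spine φ) k (λ i b → run n e (node i (node b x))) a
                ⟨ iterateCost (spine φ) k (λ i b → run n e (node i (node b x)))
                                          (λ i b → cost n e (node i (node b x))) a ⟩
  loopBody⇓ e ι self eq imp leaf       k          a x f = ⇓leaf ⇓var ⇓var
  loopBody⇓ e ι self eq imp (node _ φ) leaf       a x f = ⇓node ⇓var (⇓leaf ⇓var ⇓var)
  loopBody⇓ e ι self eq imp (node p φ) (node y k) a x f =
    ⇓node ⇓var (⇓node ⇓var (⇓call
      (⇓∷ ⇓var (⇓∷ ⇓var (⇓∷ (⇓bind (⇓cons ⇓var (⇓cons ⇓var ⇓var))
         (imp (node k (node a x) ∷ y ∷ k ∷ p ∷ φ ∷ node p φ ∷ node y k ∷ a ∷ x ∷ f ∷ []) 9F 0F))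
        (⇓∷ ⇓var (⇓∷ ⇓var ⇓[])))))
      (subst (λ b → φ ∷ k ∷ _ ∷ x ∷ f ∷ [] ⊢ b ⇓ _ ⟨ _ ⟩) (sym eq)
        (loopBody⇓ e ι self eq imp φ k _ x f))))

  -- The hypothesis says that the global table agrees with `bodies c` on the loops of `c`; `onˡ` and
  -- `onʳ` pass it on to the subcodes.
  sound : ∀ c ι → (∀ i → B (ι i) ≡ bodies c ι i) → Implements c ι
  sound input          ι h ρ f x = ⇓var
  sound nil            ι h ρ f x = ⇓nil
  sound (pair c d)     ι h ρ f x =
    ⇓cons (sound c _ (onˡ h) ρ f x) (sound d _ (onʳ h) ρ f x)
  sound (comp c d)     ι h ρ f x =
    ⇓bind (sound c _ (onˡ h) ρ f x) (sound d _ (onʳ h) (_ ∷ ρ) (suc f) 0F)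
  sound (hd c)         ι h ρ f x = left⇓ (sound c ι h ρ f x)
  sound (tl c)         ι h ρ f x = right⇓ (sound c ι h ρ f x)
  sound (ifLeaf c d e) ι h ρ f x =
    branch⇓ (sound c _ (onˡ h) ρ f x)
            (sound d _ (onˡ (onʳ {a = loops c} h)) ρ f x)
            (λ {a} {b} → sound e _ (onʳ (onʳ {a = loops c} h)) (a ∷ b ∷ ρ) (suc (suc f)) (suc (suc x)))
  sound (loop c d e)   ι h ρ f x =
    ⇓call (⇓∷ ⇓var (⇓∷ (sound c _ (onˡ (h ∘ suc)) ρ f x)
                   (⇓∷ (sound d _ (onˡ (onʳ {a = loops c} (h ∘ suc))) ρ f x)
                   (⇓∷ ⇓var (⇓∷ ⇓var ⇓[])))))
          (subst (λ b → _ ⊢ b ⇓ _ ⟨ _ ⟩) (sym (h 0F))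
            (loopBody⇓ e _ (ι 0F) (h 0F) (sound e _ (onʳ (onʳ {a = loops c} (h ∘ suc)))) _ _ _ _ _))

-- Polynomial cost bounds

-- With the nonzero base `suc n` powers grow with the exponent, so two bounds can be raised to a
-- common degree also at n = 0.
PolynomiallyBounded : (ℕ → ℕ) → Set
PolynomiallyBounded f = ∃[ c ] ∃[ d ] ∀ n → f n ≤ c * suc n ^ d

const-bounded : ∀ c → PolynomiallyBounded (λ _ → c)
const-bounded c = c , 0 , λ n → ≤-reflexive (sym (*-identityʳ c))

id-bounded : PolynomiallyBounded id
id-bounded = 1 , 1 , λ n → ≤-trans (n≤1+n n) (≤-reflexive (sym (trans (*-identityˡ _) (*-identityʳ _))))

+-bounded : ∀ {f g} → PolynomiallyBounded f → PolynomiallyBounded g →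
            PolynomiallyBounded (λ n → f n + g n)
+-bounded (c , d , p) (c′ , d′ , q) = c + c′ , d + d′ , λ n →
  ≤-trans (+-mono-≤ (≤-trans (p n) (*-monoʳ-≤ c (^-monoʳ-≤ (suc n) (m≤m+n d d′))))
                    (≤-trans (q n) (*-monoʳ-≤ c′ (^-monoʳ-≤ (suc n) (m≤n+m d′ d)))))
          (≤-reflexive (sym (*-distribʳ-+ (suc n ^ (d + d′)) c c′)))

*-bounded : ∀ {f g} → PolynomiallyBounded f → PolynomiallyBounded g →
            PolynomiallyBounded (λ n → f n * g n)
*-bounded (c , d , p) (c′ , d′ , q) = c * c′ , d + d′ , λ n →
  ≤-trans (*-mono-≤ (p n) (q n)) (≤-reflexive
    (trans ([m*n]*[o*p]≡[m*o]*[n*p] c (suc n ^ d) c′ (suc n ^ d′))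
           (cong (c * c′ *_) (sym (^-distribˡ-+-* (suc n) d d′)))))

-- A function of the fuel alone: both branches of a conditional are charged, and a loop makes at
-- most n rounds. The overhead of a round is 15 = 5 + 2 + 6 + 2, as in `iterateCost`.
costBound : Code → ℕ → ℕ
costBound input          n = 1
costBound nil            n = 1
costBound (pair c d)     n = 1 + (costBound c n + costBound d n)
costBound (comp c d)     n = 1 + (costBound c n + costBound d n)
costBound (hd c)         n = 1 + (costBound c n + 1)
costBound (tl c)         n = 1 + (costBound c n + 1)
costBound (ifLeaf c d e) n = 1 + (costBound c n + (costBound d n + costBound e n))
costBound (loop c d e)   n =
  2 + (costBound c n + (costBound d n + 2)) + (n * (15 + costBound e n) + 5)

costBound-bounded : ∀ c → PolynomiallyBounded (costBound c)
costBound-bounded input          = const-bounded 1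
costBound-bounded nil            = const-bounded 1
costBound-bounded (pair c d)     =
  +-bounded (const-bounded 1) (+-bounded (costBound-bounded c) (costBound-bounded d))
costBound-bounded (comp c d)     =
  +-bounded (const-bounded 1) (+-bounded (costBound-bounded c) (costBound-bounded d))
costBound-bounded (hd c)         =
  +-bounded (const-bounded 1) (+-bounded (costBound-bounded c) (const-bounded 1))
costBound-bounded (tl c)         =
  +-bounded (const-bounded 1) (+-bounded (costBound-bounded c) (const-bounded 1))
costBound-bounded (ifLeaf c d e) =
  +-bounded (const-bounded 1) (+-bounded (costBound-bounded c)
    (+-bounded (costBound-bounded d) (costBound-bounded e)))
costBound-bounded (loop c d e)   =
  +-bounded (+-bounded (const-bounded 2) (+-bounded (costBound-bounded c)
              (+-bounded (costBound-bounded d) (const-bounded 2))))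
            (+-bounded (*-bounded id-bounded (+-bounded (const-bounded 15) (costBound-bounded e)))
              (const-bounded 5))

branch-≤ : ∀ t {a b} → branch t a b ≤ a + b
branch-≤ leaf       = m≤m+n _ _
branch-≤ (node _ _) = m≤n+m _ _

iterateCost-≤ : ∀ n c f g a {b} → (∀ i x → g i x ≤ b) → iterateCost n c f g a ≤ n * (15 + b) + 5
iterateCost-≤ zero    c          f g a h = s≤s (s≤s (s≤s z≤n))
iterateCost-≤ (suc n) leaf       f g a {b} h = m≤n+m 5 (suc n * (15 + b))
iterateCost-≤ (suc n) (node _ c) f g a {b} h = begin
  5 + (2 + (6 + g c a + 2) + iterateCost n c f g (f c a))
    ≤⟨ +-monoʳ-≤ 5 (+-mono-≤ (+-monoʳ-≤ 2 (+-monoˡ-≤ 2 (+-monoʳ-≤ 6 (h c a))))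
                             (iterateCost-≤ n c f g _ h)) ⟩
  5 + (2 + (6 + b + 2) + (n * (15 + b) + 5))
    ≡⟨ cong (λ t → 5 + (2 + t + (n * (15 + b) + 5))) (+-comm (6 + b) 2) ⟩
  15 + b + (n * (15 + b) + 5)  ≡⟨ +-assoc (15 + b) _ _ ⟨
  suc n * (15 + b) + 5 ∎
  where open ≤-Reasoning

cost-≤ : ∀ n c x → cost n c x ≤ costBound c n
cost-≤ n input          x = ≤-refl
cost-≤ n nil            x = ≤-refl
cost-≤ n (pair c d)     x = s≤s (+-mono-≤ (cost-≤ n c x) (cost-≤ n d x))
cost-≤ n (comp c d)     x = s≤s (+-mono-≤ (cost-≤ n c x) (cost-≤ n d _))
cost-≤ n (hd c)         x = s≤s (+-monoˡ-≤ 1 (cost-≤ n c x))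
cost-≤ n (tl c)         x = s≤s (+-monoˡ-≤ 1 (cost-≤ n c x))
cost-≤ n (ifLeaf c d e) x = s≤s (+-mono-≤ (cost-≤ n c x)
  (≤-trans (branch-≤ (run n c x)) (+-mono-≤ (cost-≤ n d x) (cost-≤ n e x))))
cost-≤ n (loop c d e)   x = s≤s (s≤s (+-mono-≤
  (+-mono-≤ (cost-≤ n c x) (+-monoˡ-≤ 2 (cost-≤ n d x)))
  (iterateCost-≤ n (run n c x) _ _ _ (λ i a → cost-≤ n e _))))

module Programs (c : Code) where

  -- The fuel is the input itself, as needed for computable functions, ...
  unaryProgram : Program
  unaryProgram = Soundness.program (bodies c id) (compile c id 0F 0F)

  unary-runs : ∀ x → Runs unaryProgram x (run (spine x) c x) (cost (spine x) c x)
  unary-runs x = Soundness.sound (bodies c id) _ c id (λ _ → refl) (x ∷ []) 0F 0F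

  -- ... or its first component, as needed for instances with a parameter.
  instanceProgram : Program
  instanceProgram = Soundness.program (bodies c id) (case (var 0F) nil (compile c id 0F 2F))

  instance-runs : ∀ x y → let n = spine x ; z = node x y in
                  Runs instanceProgram z (run n c z) (2 + cost n c z)
  instance-runs x y = ⇓node ⇓var
    (sound c id (λ _ → refl) (x ∷ y ∷ node x y ∷ []) 0F 2F)
    where
    open Soundness (bodies c id) (case (var 0F) nil (compile c id 0F 2F))
    open Semantics program

foldFin : ∀ {a} {A : Set a} n → (Fin n → A → A) → A → A
foldFin zero    f z = z
foldFin (suc n) f z = f zero (foldFin n (λ i → f (suc i)) z)

-- A counter for m + 1 rounds first hands the index m to its body, so a loop visits the indices
-- downwards. Peeling off the last index of a fold exposes the first round of the loop.
foldFin-last : ∀ {a} {A : Set a} n (f : Fin (suc n) → A → A) z →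
               foldFin (suc n) f z ≡ foldFin n (f ∘ inject₁) (f (fromℕ n) z)
foldFin-last zero    f z = refl
foldFin-last (suc n) f z = cong (f zero) (foldFin-last n (f ∘ suc) z)

iterate-leaf : ∀ n f a → iterate n leaf f a ≡ a
iterate-leaf zero    f a = refl
iterate-leaf (suc n) f a = refl

iterate-foldFin : ∀ {a} {A : Set a} (enc : A → Tree) (h : Tree → Tree → Tree) →
  ∀ n m (f : Fin m → A → A) → m ≤ n → (∀ i x → h ⟦ toℕ i ⟧ℕ (enc x) ≡ enc (f i x)) →
  ∀ z → iterate n ⟦ m ⟧ℕ h (enc z) ≡ enc (foldFin m f z)
iterate-foldFin enc h n       zero    f le     eq z = iterate-leaf n h (enc z)
iterate-foldFin enc h (suc n) (suc m) f (s≤s le) eq z = begin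
  iterate n ⟦ m ⟧ℕ h (h ⟦ m ⟧ℕ (enc z))
    ≡⟨ cong (λ k → iterate n ⟦ m ⟧ℕ h (h ⟦ k ⟧ℕ (enc z))) (sym (toℕ-fromℕ m)) ⟩
  iterate n ⟦ m ⟧ℕ h (h ⟦ toℕ (fromℕ m) ⟧ℕ (enc z))
    ≡⟨ cong (iterate n ⟦ m ⟧ℕ h) (eq (fromℕ m) z) ⟩
  iterate n ⟦ m ⟧ℕ h (enc (f (fromℕ m) z))
    ≡⟨ iterate-foldFin enc h n m (f ∘ inject₁) le
         (λ i x → trans (cong (λ k → h ⟦ k ⟧ℕ (enc x)) (sym (toℕ-inject₁ i))) (eq (inject₁ i) x)) _ ⟩
  enc (foldFin m (f ∘ inject₁) (f (fromℕ m) z))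
    ≡⟨ cong enc (sym (foldFin-last m f z)) ⟩
  enc (foldFin (suc m) f z) ∎
  where open ≡-Reasoning

-- A typed language over the vertices of a graph

infixr 6 _⊗_


data Ty : Set where
  bool nat fin : Ty
  _⊗_          : Ty → Ty → Ty
  opt vec list : Ty → Ty

⟦_⟧ : Ty → ℕ → Set
⟦ bool   ⟧ n = Bool
⟦ nat    ⟧ n = ℕ
⟦ fin    ⟧ n = Fin n
⟦ σ ⊗ τ  ⟧ n = ⟦ σ ⟧ n × ⟦ τ ⟧ n
⟦ opt τ  ⟧ n = Maybe (⟦ τ ⟧ n)
⟦ vec τ  ⟧ n = Fin n → ⟦ τ ⟧ n
⟦ list τ ⟧ n = List (⟦ τ ⟧ n)

enc : ∀ {n} τ → ⟦ τ ⟧ n → Tree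
enc bool     b        = ⟦ b ⟧Bool
enc nat      k        = ⟦ k ⟧ℕ
enc fin      i        = ⟦ toℕ i ⟧ℕ
enc (σ ⊗ τ)  (x , y)  = node (enc σ x) (enc τ y)
enc (opt τ)  nothing  = leaf
enc (opt τ)  (just x) = node leaf (enc τ x)
enc (vec τ)  v        = ⟦ tabulate (enc τ ∘ v) ⟧List
enc (list τ) xs       = ⟦ List.map (enc τ) xs ⟧List

Cxt : Set
Cxt = List Ty

Env : ℕ → Cxt → Set
Env n []      = ⊤
Env n (τ ∷ Γ) = ⟦ τ ⟧ n × Env n Γ

get : ∀ {n} Γ (i : Fin (length Γ)) → Env n Γ → ⟦ List.lookup Γ i ⟧ n
get (τ ∷ Γ) zero    (x , ρ) = x
get (τ ∷ Γ) (suc i) (x , ρ) = get Γ i ρ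

-- In a context with n vertices, `fin` stands for the vertices and a loop
-- visits all of them.
data Tm (Γ : Cxt) : Ty → Set where
  var       : (i : Fin (length Γ)) → Tm Γ (List.lookup Γ i)
  `true     : Tm Γ bool
  `false    : Tm Γ bool
  `if       : ∀ {τ} → Tm Γ bool → Tm Γ τ → Tm Γ τ → Tm Γ τ
  `zero     : Tm Γ nat
  `pred     : Tm Γ nat → Tm Γ nat
  `ifZero   : ∀ {τ} → Tm Γ nat → Tm Γ τ → Tm Γ τ → Tm Γ τ
  `eq       : Tm Γ fin → Tm Γ fin → Tm Γ bool
  _`,_      : ∀ {σ τ} → Tm Γ σ → Tm Γ τ → Tm Γ (σ ⊗ τ)
  `fst      : ∀ {σ τ} → Tm Γ (σ ⊗ τ) → Tm Γ σ
  `snd      : ∀ {σ τ} → Tm Γ (σ ⊗ τ) → Tm Γ τ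
  `nothing  : ∀ {τ} → Tm Γ (opt τ)
  `just     : ∀ {τ} → Tm Γ τ → Tm Γ (opt τ)
  `maybe    : ∀ {σ τ} → Tm (σ ∷ Γ) τ → Tm Γ τ → Tm Γ (opt σ) → Tm Γ τ
  `lookup   : ∀ {τ} → Tm Γ (vec τ) → Tm Γ fin → Tm Γ τ
  `tabulate : ∀ {τ} → Tm (fin ∷ Γ) τ → Tm Γ (vec τ)
  `fold     : ∀ {τ} → Tm (fin ∷ τ ∷ Γ) τ → Tm Γ τ → Tm Γ τ
  `[]       : ∀ {τ} → Tm Γ (list τ)
  _`∷_      : ∀ {τ} → Tm Γ τ → Tm Γ (list τ) → Tm Γ (list τ)
  `call     : ∀ {Δ τ} → Tm Δ τ → All (Tm Γ) Δ → Tm Γ τ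

ifZero : ∀ {a} {A : Set a} → ℕ → A → A → A
ifZero zero    x y = x
ifZero (suc _) x y = y

eval  : ∀ {n Γ τ} → Tm Γ τ → Env n Γ → ⟦ τ ⟧ n
evals : ∀ {n Γ Δ} → All (Tm Γ) Δ → Env n Γ → Env n Δ

eval (var i)        ρ = get _ i ρ
eval `true          ρ = true
eval `false         ρ = false
eval (`if b t u)    ρ = if eval b ρ then eval t ρ else eval u ρ
eval `zero          ρ = 0
eval (`pred t)      ρ = pred (eval t ρ)
eval (`ifZero b t u) ρ = ifZero (eval b ρ) (eval t ρ) (eval u ρ)
eval (`eq t u)      ρ = does (eval t ρ ≟ eval u ρ)
eval (t `, u)       ρ = eval t ρ , eval u ρ
eval (`fst t)       ρ = proj₁ (eval t ρ)
eval (`snd t)       ρ = proj₂ (eval t ρ)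
eval `nothing       ρ = nothing
eval (`just t)      ρ = just (eval t ρ)
eval (`maybe t u m) ρ = maybe′ (λ x → eval t (x , ρ)) (eval u ρ) (eval m ρ)
eval (`lookup t u)  ρ = eval t ρ (eval u ρ)
eval (`tabulate t)  ρ = λ i → eval t (i , ρ)
eval (`fold t u)    ρ = foldFin _ (λ i x → eval t (i , x , ρ)) (eval u ρ)
eval `[]            ρ = []
eval (t `∷ u)       ρ = eval t ρ ∷ eval u ρ
eval (`call t us)   ρ = eval t (evals us ρ)

evals []       ρ = tt
evals (t ∷ ts) ρ = eval t ρ , evals ts ρ

-- At the bottom of every environment lies n in unary, the counter of all loops.
pack : ∀ {n} Γ → Env n Γ → Tree
pack {n} []      ρ       = ⟦ n ⟧ℕ
pack     (τ ∷ Γ) (x , ρ) = node (enc τ x) (pack Γ ρ)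

vertexCount : Cxt → Code
vertexCount []      = input
vertexCount (_ ∷ Γ) = comp (tl input) (vertexCount Γ)

run-vertexCount : ∀ {n} k Γ (ρ : Env n Γ) → run k (vertexCount Γ) (pack Γ ρ) ≡ ⟦ n ⟧ℕ
run-vertexCount k []      ρ       = refl
run-vertexCount k (_ ∷ Γ) (_ , ρ) = run-vertexCount k Γ ρ

project : (Γ : Cxt) → Fin (length Γ) → Code
project (_ ∷ Γ) zero    = hd input
project (_ ∷ Γ) (suc i) = comp (tl input) (project Γ i)

run-project : ∀ {n} k Γ i (ρ : Env n Γ) →
               run k (project Γ i) (pack Γ ρ) ≡ enc (List.lookup Γ i) (get Γ i ρ)
run-project k (_ ∷ Γ) zero    (_ , ρ) = refl
run-project k (_ ∷ Γ) (suc i) (_ , ρ) = run-project k Γ i ρ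

⌜true⌝ : Code
⌜true⌝ = pair nil nil

dropTree : ℕ → Tree → Tree
dropTree zero    t = t
dropTree (suc i) t = dropTree i (right t)

iterate-right : ∀ n i → i ≤ n → ∀ t → iterate n ⟦ i ⟧ℕ (λ _ → right) t ≡ dropTree i t
iterate-right n       zero    le       t = iterate-leaf n _ t
iterate-right (suc n) (suc i) (s≤s le) t = iterate-right n i le (right t)

-- One primitive serves both indexing and comparison: dropping i cells of a list exposes entry i,
-- and dropping i from a unary number is truncated subtraction.
drop : Code → Code → Code
drop i t = loop i t (tl (hd (tl input)))

run-drop : ∀ n i t x k → k ≤ n → run n i x ≡ ⟦ k ⟧ℕ → run n (drop i t) x ≡ dropTree k (run n t x)
run-drop n i t x k le eq rewrite eq = iterate-right n k le (run n t x)

dropTree-tabulate : ∀ {n} (v : Fin n → Tree) i →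
                    left (dropTree (toℕ i) ⟦ tabulate v ⟧List) ≡ v i
dropTree-tabulate v zero    = refl
dropTree-tabulate v (suc i) = dropTree-tabulate (v ∘ suc) i

dropTree-∸ : ∀ i j → dropTree i ⟦ j ⟧ℕ ≡ ⟦ j ∸ i ⟧ℕ
dropTree-∸ zero    j       = refl
dropTree-∸ (suc i) zero    = trans (dropTree-∸ i 0) (cong ⟦_⟧ℕ (0∸n≡0 i))
dropTree-∸ (suc i) (suc j) = dropTree-∸ i j

tabulate-foldFin : ∀ {n} (v : Fin n → Tree) →
                   foldFin n (λ i → node (v i)) leaf ≡ ⟦ tabulate v ⟧List
tabulate-foldFin {zero}  v = refl
tabulate-foldFin {suc n} v = cong (node (v zero)) (tabulate-foldFin (v ∘ suc))

private
  rest : Code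
  rest = tl (tl input)

  index acc : Code
  index = hd input
  acc   = hd (tl input)

code  : ∀ {Γ τ} → Tm Γ τ → Code
codes : ∀ {Γ Δ} → All (Tm Γ) Δ → Code

code {Γ} (var i)        = project Γ i
code `true              = ⌜true⌝
code `false             = nil
code (`if b t u)        = ifLeaf (code b) (code u) (code t)
code `zero              = nil
code (`pred t)          = tl (code t)
code (`ifZero b t u)    = ifLeaf (code b) (code t) (code u)
code (`eq t u)          =
  ifLeaf (drop (code t) (code u)) (ifLeaf (drop (code u) (code t)) ⌜true⌝ nil) nil
code (t `, u)           = pair (code t) (code u)
code (`fst t)           = hd (code t)
code (`snd t)           = tl (code t)
code `nothing           = nil
code (`just t)          = pair nil (code t)
-- The scrutinee is evaluated twice, which for a fixed term changes the cost only by a constant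
-- factor.
code (`maybe t u m)     = ifLeaf (code m) (code u) (comp (pair (tl (code m)) input) (code t))
code (`lookup t u)      = hd (drop (code u) (code t))
code {Γ} (`tabulate t)  =
  loop (vertexCount Γ) nil (pair (comp (pair index rest) (code t)) acc)
code {Γ} (`fold t u)    = loop (vertexCount Γ) (code u) (code t)
code `[]                = nil
code (t `∷ u)           = pair (code t) (code u)
code (`call t us)       = comp (codes us) (code t)

codes {Γ} []    = vertexCount Γ
codes (t ∷ ts)  = pair (code t) (codes ts)

branch-Bool : ∀ b {t u : Tree} → branch ⟦ b ⟧Bool u t ≡ (if b then t else u)
branch-Bool false = refl
branch-Bool true  = refl

branch-ifZero : ∀ {n} τ k {x y : ⟦ τ ⟧ n} →
                branch ⟦ k ⟧ℕ (enc τ x) (enc τ y) ≡ enc τ (ifZero k x y)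
branch-ifZero τ zero    = refl
branch-ifZero τ (suc k) = refl

right-ℕ : ∀ k → right ⟦ k ⟧ℕ ≡ ⟦ pred k ⟧ℕ
right-ℕ zero    = refl
right-ℕ (suc k) = refl

branch-maybe : ∀ {n} σ τ (m : Maybe (⟦ σ ⟧ n)) (f : ⟦ σ ⟧ n → ⟦ τ ⟧ n) y (h : Tree → Tree) →
               (∀ x → h (enc σ x) ≡ enc τ (f x)) →
               branch (enc (opt σ) m) (enc τ y) (h (right (enc (opt σ) m))) ≡ enc τ (maybe′ f y m)
branch-maybe σ τ nothing  f y h eq = refl
branch-maybe σ τ (just x) f y h eq = eq x

-- Two numbers are equal exactly when both truncated differences vanish.
branch-eq : ∀ {n} (i j : Fin n) →
  branch ⟦ toℕ j ∸ toℕ i ⟧ℕ (branch ⟦ toℕ i ∸ toℕ j ⟧ℕ (node leaf leaf) leaf) leaf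
  ≡ ⟦ does (i ≟ j) ⟧Bool
branch-eq i j with i ≟ j
... | yes refl rewrite n∸n≡0 (toℕ i) = refl
... | no  i≢j with toℕ j ∸ toℕ i in p | toℕ i ∸ toℕ j in q
...   | suc _ | _     = refl
...   | zero  | suc _ = refl
...   | zero  | zero  with () ← i≢j (toℕ-injective (≤-antisym (m∸n≡0⇒m≤n q) (m∸n≡0⇒m≤n p)))

run-code  : ∀ {n Γ τ} (t : Tm Γ τ) (ρ : Env n Γ) →
            run n (code t) (pack Γ ρ) ≡ enc τ (eval t ρ)
run-codes : ∀ {n Γ Δ} (ts : All (Tm Γ) Δ) (ρ : Env n Γ) →
            run n (codes ts) (pack Γ ρ) ≡ pack Δ (evals ts ρ)

run-code {n} {Γ} (var i) ρ = run-project n Γ i ρ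
run-code `true  ρ = refl
run-code `false ρ = refl
run-code {τ = τ} (`if b t u) ρ
  rewrite run-code b ρ | run-code t ρ | run-code u ρ =
  trans (branch-Bool (eval b ρ)) (sym (if-float (enc τ) (eval b ρ)))
run-code `zero ρ = refl
run-code (`pred t) ρ rewrite run-code t ρ = right-ℕ (eval t ρ)
run-code {τ = τ} (`ifZero b t u) ρ
  rewrite run-code b ρ | run-code t ρ | run-code u ρ = branch-ifZero τ (eval b ρ)
run-code {n} {Γ} (`eq t u) ρ
  rewrite run-drop n (code t) (code u) _ _ (<⇒≤ (toℕ<n (eval t ρ))) (run-code t ρ)
        | run-drop n (code u) (code t) _ _ (<⇒≤ (toℕ<n (eval u ρ))) (run-code u ρ)
        | run-code t ρ | run-code u ρ
        | dropTree-∸ (toℕ (eval t ρ)) (toℕ (eval u ρ))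
        | dropTree-∸ (toℕ (eval u ρ)) (toℕ (eval t ρ)) = branch-eq (eval t ρ) (eval u ρ)
run-code (t `, u) ρ = cong₂ node (run-code t ρ) (run-code u ρ)
run-code (`fst t) ρ rewrite run-code t ρ = refl
run-code (`snd t) ρ rewrite run-code t ρ = refl
run-code `nothing ρ = refl
run-code (`just t) ρ = cong (node leaf) (run-code t ρ)
run-code {n} {Γ} {τ} (`maybe {σ} t u m) ρ
  rewrite run-code m ρ | run-code u ρ =
  branch-maybe σ τ (eval m ρ) _ _ (λ y → run n (code t) (node y (pack Γ ρ)))
    (λ x → run-code t (x , ρ))
run-code {n} {τ = τ} (`lookup t u) ρ
  rewrite run-drop n (code u) (code t) _ _ (<⇒≤ (toℕ<n (eval u ρ))) (run-code u ρ)
        | run-code t ρ = dropTree-tabulate (enc τ ∘ eval t ρ) (eval u ρ)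
run-code {n} {Γ} {vec τ} (`tabulate t) ρ rewrite run-vertexCount n Γ ρ =
  trans (iterate-foldFin id _ n n (λ i → node (enc τ (eval t (i , ρ)))) ≤-refl
          (λ i x → cong (λ y → node y x) (run-code t (i , ρ))) leaf)
        (tabulate-foldFin _)
run-code {n} {Γ} {τ} (`fold t u) ρ rewrite run-vertexCount n Γ ρ | run-code u ρ =
  iterate-foldFin (enc τ) _ n n _ ≤-refl (λ i x → run-code t (i , x , ρ)) _
run-code `[] ρ = refl
run-code (t `∷ u) ρ = cong₂ node (run-code t ρ) (run-code u ρ)
run-code {n} (`call t us) ρ =
  trans (cong (run n (code t)) (run-codes us ρ)) (run-code t (evals us ρ))

run-codes {n} {Γ} [] ρ = run-vertexCount n Γ ρ
run-codes (t ∷ ts)   ρ = cong₂ node (run-code t ρ) (run-codes ts ρ)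

-- The algorithm

Mask : ℕ → Set
Mask n = Fin n → Bool

Relation : ℕ → Set
Relation n = Fin n → Fin n → Bool

-- M h ≡ just c means that h is used to cover c.
Mate : ℕ → Set
Mate n = Fin n → Maybe (Fin n)

infixl 8 _[_≔_]
_[_≔_] : ∀ {n} {X : Set} → (Fin n → X) → Fin n → X → Fin n → X
(v [ i ≔ x ]) j = if does (i ≟ j) then x else v j

infixl 6 _minus_
_minus_ : ∀ {n} → ℕ → Mask n → ℕ
_minus_ {n} k S = foldFin n (λ i r → if S i then pred r else r) k

module _ {n : ℕ} (A : Relation n) where

  matchPair : Fin n → Fin n → Mask n × ℕ → Mask n × ℕ
  matchPair i j s =
    if proj₁ s i
    then (if proj₁ s j
          then (if A i j
                then (proj₁ s [ i ≔ false ] [ j ≔ false ] , pred (proj₂ s))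
                else s)
          else s)
    else s

  -- Returns the vertices left unmatched and the parameter minus the number of
  -- matched pairs.
  greedy : Mask n × ℕ → Mask n × ℕ
  greedy = foldFin n λ i s → foldFin n (λ j → matchPair i j) s

  -- The state of a search from a vertex u that the current matching M leaves
  -- exposed: each reached vertex c comes with the result of switching M along
  -- an alternating path from u to c, so that c is exposed instead of u.  The
  -- second component is an augmented matching, once one has been found.
  Search : Set
  Search = (Fin n → Maybe (Mate n)) × Maybe (Mate n)

  -- Along the edge from `c` to `h`, `h` is given to `c`. If `M` leaves `h` free, the matching has
  -- grown; otherwise the former owner `d` of `h` is exposed in place of `c` and counts as reached.
  -- As whole matchings are stored instead of predecessors, no path has to be traced back.
  extend : Mask n → Mate n → Fin n → Fin n → Search → Search
  extend S M c h s =
    maybe′ (λ _ → s)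
      (maybe′ (λ N →
        if A c h
        then (if S h
              then maybe′ (λ d → maybe′ (λ _ → s)
                                        (proj₁ s [ d ≔ just (N [ h ≔ just c ]) ] , nothing)
                                        (proj₁ s d))
                          (proj₁ s , just (N [ h ≔ just c ]))
                          (M h)
              else s)
        else s) s (proj₁ s c))
      (proj₂ s)

  extendAll : Mask n → Mate n → Search → Search
  extendAll S M s = foldFin n (λ c s → foldFin n (λ h → extend S M c h) s) s

  search : Mask n → Mate n → Fin n → Search
  search S M u =
    foldFin n (λ _ → extendAll S M) ((λ _ → nothing) [ u ≔ just M ] , nothing)

  reached : Search → Mask n
  reached s c = maybe′ (λ _ → true) false (proj₁ s c)

  augment : Mask n → Mask n → Fin n → Mate n × Maybe (Mask n) → Mate n × Maybe (Mask n)
  augment S I u s =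
    maybe′ (λ _ → s)
      (if I u
       then maybe′ (λ N → N , nothing)
                   (proj₁ s , just (reached (search S (proj₁ s) u)))
                   (proj₂ (search S (proj₁ s) u))
       else s)
      (proj₂ s)

  -- The second component is the set reached by the first search that failed.
  assign : Mask n → Mask n → Mate n × Maybe (Mask n)
  assign S I = foldFin n (augment S I) ((λ _ → nothing) , nothing)

  partners : Mate n → Mask n → Mask n
  partners M C h = maybe′ C false (M h)

  removeCrown : Mate n → Mask n → Mask n × ℕ → Mask n × ℕ
  removeCrown M C s =
    (λ i → if C i then false else if partners M C i then false else proj₁ s i) ,
    proj₂ s minus partners M C

  reduce : Mask n × ℕ → Mask n × ℕ
  reduce s = maybe′ (λ C → removeCrown (proj₁ (assign (proj₁ s) (proj₁ (greedy s)))) C s) s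
                    (proj₂ (assign (proj₁ s) (proj₁ (greedy s))))

  -- Every round that finds a crown deletes a vertex, so n + 1 rounds cannot all find one. A loop
  -- makes n rounds, hence the extra call.
  reduceAll : ℕ → Mask n × ℕ
  reduceAll k = reduce (foldFin n (λ _ → reduce) ((λ _ → true) , k))

  rows : Mask n → List (List Bool)
  rows S = foldFin n (λ i rs →
    if S i then foldFin n (λ j r → if S j then A i j ∷ r else r) [] ∷ rs else rs) []

  -- The tests are truncated differences: they vanish when the greedy matching, or the number of
  -- vertices it leaves, reaches the parameter. Then the answer is yes, for which the empty graph
  -- with parameter 0 is a fixed instance.
  finish : Mask n × ℕ → List (List Bool) × ℕ
  finish s = ifZero (proj₂ (greedy s)) ([] , 0)
            (ifZero (proj₂ s minus proj₁ (greedy s)) ([] , 0)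
            (rows (proj₁ s) , proj₂ s))

-- The algorithm as a program

private
  mask mate adjacency state searchState : Ty
  mask        = vec bool
  mate        = vec (opt fin)
  adjacency   = vec mask
  state       = mask ⊗ nat
  searchState = vec (opt mate) ⊗ opt mate

  `update : ∀ {τ} → Tm (vec τ ∷ fin ∷ τ ∷ []) (vec τ)
  `update = `tabulate (`if (`eq (var 2F) (var 0F)) (var 3F) (`lookup (var 1F) (var 0F)))

  `minus : Tm (nat ∷ mask ∷ []) nat
  `minus = `fold (`if (`lookup (var 3F) (var 0F)) (`pred (var 1F)) (var 1F)) (var 0F)

  `matchPair : Tm (adjacency ∷ fin ∷ fin ∷ state ∷ []) state
  `matchPair =
    `if (`lookup (`fst (var 3F)) (var 1F))
      (`if (`lookup (`fst (var 3F)) (var 2F))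
        (`if (`lookup (`lookup (var 0F) (var 1F)) (var 2F))
          (`call `update
             (`call `update (`fst (var 3F) ∷ var 1F ∷ `false ∷ []) ∷ var 2F ∷ `false ∷ [])
           `, `pred (`snd (var 3F)))
          (var 3F))
        (var 3F))
      (var 3F)

  `greedy : Tm (adjacency ∷ state ∷ []) state
  `greedy = `fold (`fold (`call `matchPair (var 4F ∷ var 2F ∷ var 0F ∷ var 1F ∷ [])) (var 1F)) (var 1F)

  `extend : Tm (adjacency ∷ mask ∷ mate ∷ fin ∷ fin ∷ searchState ∷ []) searchState
  `extend =
    `maybe (var 6F)
      (`maybe
        (`if (`lookup (`lookup (var 1F) (var 4F)) (var 5F))
          (`if (`lookup (var 2F) (var 5F))
            (`maybe
              (`maybe (var 8F)
                (`call `update (`fst (var 7F) ∷ var 0F ∷ `just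
                   (`call `update (var 1F ∷ var 6F ∷ `just (var 5F) ∷ [])) ∷ []) `, `nothing)
                (`lookup (`fst (var 7F)) (var 0F)))
              (`fst (var 6F) `, `just (`call `update (var 0F ∷ var 5F ∷ `just (var 4F) ∷ [])))
              (`lookup (var 3F) (var 5F)))
            (var 6F))
          (var 6F))
        (var 5F)
        (`lookup (`fst (var 5F)) (var 3F)))
      (`snd (var 5F))

  `extendAll : Tm (adjacency ∷ mask ∷ mate ∷ searchState ∷ []) searchState
  `extendAll = `fold (`fold
    (`call `extend (var 4F ∷ var 5F ∷ var 6F ∷ var 2F ∷ var 0F ∷ var 1F ∷ [])) (var 1F)) (var 3F)

  `search : Tm (adjacency ∷ mask ∷ mate ∷ fin ∷ []) searchState
  `search = `fold (`call `extendAll (var 2F ∷ var 3F ∷ var 4F ∷ var 1F ∷ []))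
    (`call `update (`tabulate `nothing ∷ var 3F ∷ `just (var 2F) ∷ []) `, `nothing)

  `reached : Tm (searchState ∷ []) mask
  `reached = `tabulate (`maybe `true `false (`lookup (`fst (var 1F)) (var 0F)))

  `augment : Tm (adjacency ∷ mask ∷ mask ∷ fin ∷ mate ⊗ opt mask ∷ []) (mate ⊗ opt mask)
  `augment =
    `maybe (var 5F)
      (`if (`lookup (var 2F) (var 3F))
        (`maybe (var 0F `, `nothing)
          (`fst (var 4F) `, `just (`call `reached (found ∷ [])))
          (`snd found))
        (var 4F))
      (`snd (var 4F))
    where
    found : Tm (adjacency ∷ mask ∷ mask ∷ fin ∷ mate ⊗ opt mask ∷ []) searchState
    found = `call `search (var 0F ∷ var 1F ∷ `fst (var 4F) ∷ var 3F ∷ [])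

  `assign : Tm (adjacency ∷ mask ∷ mask ∷ []) (mate ⊗ opt mask)
  `assign = `fold (`call `augment (var 2F ∷ var 3F ∷ var 4F ∷ var 0F ∷ var 1F ∷ []))
                  (`tabulate `nothing `, `nothing)

  `partners : Tm (mate ∷ mask ∷ []) mask
  `partners = `tabulate (`maybe (`lookup (var 3F) (var 0F)) `false (`lookup (var 1F) (var 0F)))

  `removeCrown : Tm (mate ∷ mask ∷ state ∷ []) state
  `removeCrown =
    `tabulate (`if (`lookup (var 2F) (var 0F)) `false
              (`if (`lookup (`call `partners (var 1F ∷ var 2F ∷ [])) (var 0F)) `false
              (`lookup (`fst (var 3F)) (var 0F))))
    `, `call `minus (`snd (var 2F) ∷ `call `partners (var 0F ∷ var 1F ∷ []) ∷ [])

  `reduce : Tm (adjacency ∷ state ∷ []) state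
  `reduce = `maybe
    (`call `removeCrown (`fst (`call `assign (var 1F ∷ `fst (var 2F) ∷
       `fst (`call `greedy (var 1F ∷ var 2F ∷ [])) ∷ [])) ∷ var 0F ∷ var 2F ∷ []))
    (var 1F)
    (`snd (`call `assign (var 0F ∷ `fst (var 1F) ∷
       `fst (`call `greedy (var 0F ∷ var 1F ∷ [])) ∷ [])))

  `reduceAll : Tm (adjacency ∷ nat ∷ []) state
  `reduceAll = `call `reduce (var 0F ∷
    `fold (`call `reduce (var 2F ∷ var 1F ∷ [])) (`tabulate `true `, var 1F) ∷ [])

  `rows : Tm (adjacency ∷ mask ∷ []) (list (list bool))
  `rows = `fold
    (`if (`lookup (var 3F) (var 0F))
      (`fold (`if (`lookup (var 5F) (var 0F))
               (`lookup (`lookup (var 4F) (var 2F)) (var 0F) `∷ var 1F) (var 1F)) `[] `∷ var 1F)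
      (var 1F))
    `[]

  `finish : Tm (adjacency ∷ state ∷ []) (list (list bool) ⊗ nat)
  `finish =
    `ifZero (`snd matched) (`[] `, `zero)
    (`ifZero (`call `minus (`snd (var 1F) ∷ `fst matched ∷ [])) (`[] `, `zero)
    (`call `rows (var 0F ∷ `fst (var 1F) ∷ []) `, `snd (var 1F)))
    where
    matched : Tm (adjacency ∷ state ∷ []) state
    matched = `call `greedy (var 0F ∷ var 1F ∷ [])

`kernelize : Tm (vec (vec bool) ∷ nat ∷ []) (list (list bool) ⊗ nat)
`kernelize = `call `finish (var 0F ∷ `call `reduceAll (var 0F ∷ var 1F ∷ []) ∷ [])

-- The terms transcribe the functions on masks literally, so both sides unfold to the same
-- expression.
eval-kernelize : ∀ {n} (A : Relation n) k → eval `kernelize (A , k , tt) ≡ finish A (reduceAll A k)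
eval-kernelize A k = refl

-- Masks and induced subgraphs

+-swap : ∀ x y z → x + (y + z) ≡ y + (x + z)
+-swap = solve-∀

⟨_⟩ : Bool → ℕ
⟨ b ⟩ = if b then 1 else 0

∣_∣ : ∀ {n} → Mask n → ℕ
∣_∣ {zero}  S = 0
∣_∣ {suc n} S = ⟨ S zero ⟩ + ∣ S ∘ suc ∣

∣∣≤n : ∀ {n} (S : Mask n) → ∣ S ∣ ≤ n
∣∣≤n {zero}  S = z≤n
∣∣≤n {suc n} S with S zero
... | true  = s≤s (∣∣≤n (S ∘ suc))
... | false = m≤n⇒m≤1+n (∣∣≤n (S ∘ suc))

∣true∣ : ∀ n → ∣ (λ (_ : Fin n) → true) ∣ ≡ n
∣true∣ zero    = refl
∣true∣ (suc n) = cong suc (∣true∣ n)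

∣∣-partition : ∀ {n} (S T U : Mask n) → (∀ i → ⟨ S i ⟩ ≡ ⟨ T i ⟩ + ⟨ U i ⟩) → ∣ S ∣ ≡ ∣ T ∣ + ∣ U ∣
∣∣-partition {zero}  S T U h = refl
∣∣-partition {suc n} S T U h = begin
  ⟨ S zero ⟩ + ∣ S ∘ suc ∣
    ≡⟨ cong₂ _+_ (h zero) (∣∣-partition (S ∘ suc) (T ∘ suc) (U ∘ suc) (h ∘ suc)) ⟩
  ⟨ T zero ⟩ + ⟨ U zero ⟩ + (∣ T ∘ suc ∣ + ∣ U ∘ suc ∣)
    ≡⟨ [m+n]+[o+p]≡[m+o]+[n+p] ⟨ T zero ⟩ _ _ _ ⟩
  ∣ T ∣ + ∣ U ∣ ∎
  where
  open ≡-Reasoning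
  [m+n]+[o+p]≡[m+o]+[n+p] : ∀ m n o p → m + n + (o + p) ≡ m + o + (n + p)
  [m+n]+[o+p]≡[m+o]+[n+p] = solve-∀

minus-∣∣ : ∀ {n} k (S : Mask n) → k minus S ≡ k ∸ ∣ S ∣
minus-∣∣ {zero}  k S = refl
minus-∣∣ {suc n} k S with S zero
... | true  = trans (cong pred (minus-∣∣ k (S ∘ suc))) (pred[m∸n]≡m∸[1+n] k _)
... | false = minus-∣∣ k (S ∘ suc)

members : ∀ {n} → Mask n → List (Fin n)
members {n} S = filterᵇ S (allFin n)

length-members : ∀ {n} (S : Mask n) → length (members S) ≡ ∣ S ∣
length-members {n} S = go n id
  where
  go : ∀ m (v : Fin m → Fin n) → length (filterᵇ S (tabulate v)) ≡ ∣ S ∘ v ∣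
  go zero    v = refl
  go (suc m) v with S (v zero)
  ... | true  = cong suc (go m (v ∘ suc))
  ... | false = go m (v ∘ suc)

foldFin-members : ∀ {n} {X : Set} (S : Mask n) (f : Fin n → X) →
  foldFin n (λ i xs → if S i then f i ∷ xs else xs) [] ≡ List.map f (members S)
foldFin-members {n} S f = go n id
  where
  go : ∀ m (v : Fin m → Fin n) →
       foldFin m (λ i xs → if S (v i) then f (v i) ∷ xs else xs) [] ≡
       List.map f (filterᵇ S (tabulate v))
  go zero    v = refl
  go (suc m) v with S (v zero)
  ... | true  = cong (f (v zero) ∷_) (go m (v ∘ suc))
  ... | false = go m (v ∘ suc)

emptyGraph : Graph
emptyGraph = record { order = 0 ; adj = λ () ; sym = λ () ; irrefl = λ () }

induced : (G : Graph) → Mask (order G) → Graph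
induced G S = record
  { order  = length (members S)
  ; adj    = λ i j → adj (vertex i) (vertex j)
  ; sym    = λ i j → Graph.sym G (vertex i) (vertex j)
  ; irrefl = λ i → irrefl (vertex i)
  }
  where
  open Graph G using (adj; irrefl)
  vertex = List.lookup (members S)

rows-members : ∀ {n} (A : Relation n) S →
               rows A S ≡ List.map (λ i → List.map (A i) (members S)) (members S)
rows-members A S = trans (foldFin-members S _)
  (map-cong (λ i → foldFin-members S (A i)) (members S))

tabulate-map : ∀ {X Y : Set} (f : X → Y) (xs : List X) →
               tabulate (f ∘ List.lookup xs) ≡ List.map f xs
tabulate-map f xs =
  trans (sym (map-tabulate (List.lookup xs) f)) (cong (List.map f) (tabulate-lookup xs))

enc-rows : ∀ G S → enc {order G} (list (list bool)) (rows (Graph.adj G) S) ≡ ⟦ induced G S ⟧Graph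
enc-rows G S = begin
  ⟦ List.map row (rows adj S) ⟧List
    ≡⟨ cong (⟦_⟧List ∘ List.map row) (rows-members adj S) ⟩
  ⟦ List.map row (List.map (λ i → List.map (adj i) L) L) ⟧List
    ≡⟨ cong ⟦_⟧List (sym (map-∘ L)) ⟩
  ⟦ List.map (λ i → row (List.map (adj i) L)) L ⟧List
    ≡⟨ cong ⟦_⟧List (map-cong (λ i → cong ⟦_⟧List (trans (sym (map-∘ L)) (sym (tabulate-map _ L)))) L) ⟩
  ⟦ List.map (λ i → ⟦ tabulate (λ j → ⟦ adj i (List.lookup L j) ⟧Bool) ⟧List) L ⟧List
    ≡⟨ cong ⟦_⟧List (sym (tabulate-map _ L)) ⟩
  ⟦ induced G S ⟧Graph ∎
  where
  open ≡-Reasoning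
  open Graph G using (adj)
  L = members S
  row : List Bool → Tree
  row = enc {order G} (list bool)

-- The kernel as a graph, and its encoding

kernelOf : (G : Graph) → Mask (order G) × ℕ → Graph × ℕ
kernelOf G s = ifZero (proj₂ matched) (emptyGraph , 0)
              (ifZero (proj₂ s minus proj₁ matched) (emptyGraph , 0)
              (induced G (proj₁ s) , proj₂ s))
  where matched = greedy (Graph.adj G) s

kernelization : Graph × ℕ → Graph × ℕ
kernelization (G , k) = kernelOf G (reduceAll (Graph.adj G) k)

⟦_⟧Output : Graph × ℕ → Tree
⟦ G , k ⟧Output = node ⟦ G ⟧Graph ⟦ k ⟧ℕ

enc-finish : ∀ G s → enc {order G} (list (list bool) ⊗ nat) (finish (Graph.adj G) s) ≡ ⟦ kernelOf G s ⟧Output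
enc-finish G s
  with proj₂ (greedy (Graph.adj G) s) | proj₂ s minus proj₁ (greedy (Graph.adj G) s)
... | zero  | _     = refl
... | suc _ | zero  = refl
... | suc _ | suc _ = cong (λ t → node t ⟦ proj₂ s ⟧ℕ) (enc-rows G (proj₁ s))

-- An encoded instance lacks the unary vertex count that `pack` expects; it is obtained by counting
-- the rows of the adjacency matrix.
withOrder : Code → Code
withOrder = comp (pair (hd input) (pair (tl input)
                   (loop (hd input) nil (pair nil (hd (tl input))))))

spine-List : ∀ {n} (f : Fin n → Tree) → spine ⟦ tabulate f ⟧List ≡ n
spine-List {zero}  f = refl
spine-List {suc n} f = cong suc (spine-List (f ∘ suc))

iterate-count : ∀ xs m →
  iterate (spine ⟦ xs ⟧List) ⟦ xs ⟧List (λ _ → node leaf) ⟦ m ⟧ℕ ≡ ⟦ length xs + m ⟧ℕ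
iterate-count []       m = refl
iterate-count (x ∷ xs) m = trans (iterate-count xs (suc m)) (cong ⟦_⟧ℕ (+-suc (length xs) m))

run-withOrder : ∀ C G k → run (order G) (withOrder C) ⟦ G , k ⟧Output ≡
                run (order G) C (pack (vec (vec bool) ∷ nat ∷ []) (Graph.adj G , k , tt))
run-withOrder C G k = cong (λ t → run n C (node g (node ⟦ k ⟧ℕ t))) count
  where
  open Graph G using (adj)
  n = order G
  g = ⟦ G ⟧Graph
  rowTrees : List Tree
  rowTrees = tabulate (λ i → ⟦ tabulate (λ j → ⟦ adj i j ⟧Bool) ⟧List)
  count : iterate n g (λ _ → node leaf) leaf ≡ ⟦ n ⟧ℕ
  count = begin
    iterate n g (λ _ → node leaf) leaf
      ≡⟨ cong (λ m → iterate m g (λ _ → node leaf) leaf) (sym (spine-List {n} _)) ⟩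
    iterate (spine ⟦ rowTrees ⟧List) ⟦ rowTrees ⟧List (λ _ → node leaf) ⟦ 0 ⟧ℕ
      ≡⟨ iterate-count rowTrees 0 ⟩
    ⟦ length rowTrees + 0 ⟧ℕ
      ≡⟨ cong ⟦_⟧ℕ (trans (+-identityʳ _) (length-tabulate {n = n} _)) ⟩
    ⟦ n ⟧ℕ ∎
    where open ≡-Reasoning

run-kernelization : ∀ G k →
  run (order G) (withOrder (code `kernelize)) ⟦ G , k ⟧Output ≡ ⟦ kernelization (G , k) ⟧Output
run-kernelization G k = begin
  run n (withOrder (code `kernelize)) ⟦ G , k ⟧Output
    ≡⟨ run-withOrder (code `kernelize) G k ⟩
  run n (code `kernelize) (pack _ (adj , k , tt))
    ≡⟨ run-code `kernelize (adj , k , tt) ⟩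
  enc {n} (list (list bool) ⊗ nat) (eval `kernelize (adj , k , tt))
    ≡⟨ cong (enc {n} (list (list bool) ⊗ nat)) (eval-kernelize adj k) ⟩
  enc {n} (list (list bool) ⊗ nat) (finish adj (reduceAll adj k))
    ≡⟨ enc-finish G (reduceAll adj k) ⟩
  ⟦ kernelization (G , k) ⟧Output ∎
  where
  open ≡-Reasoning
  open Graph G using (adj)
  n = order G

-- Sizes and running time

size-tabulate : ∀ {n b} (f : Fin n → Tree) → (∀ i → size (f i) ≤ b) →
                size ⟦ tabulate f ⟧List ≤ 1 + n * (1 + b)
size-tabulate {zero}  f h = s≤s z≤n
size-tabulate {suc n} {b} f h =
  s≤s (≤-trans (+-mono-≤ (h zero) (size-tabulate (f ∘ suc) (h ∘ suc)))
      (≤-reflexive (+-suc b (n * (1 + b)))))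

n<size-tabulate : ∀ {n} (f : Fin n → Tree) → suc n ≤ size ⟦ tabulate f ⟧List
n<size-tabulate {zero}  f = s≤s z≤n
n<size-tabulate {suc n} f = s≤s (≤-trans (n<size-tabulate (f ∘ suc)) (m≤n+m _ (size (f zero))))

size-Bool : ∀ b → size ⟦ b ⟧Bool ≤ 3
size-Bool true  = ≤-refl
size-Bool false = s≤s z≤n

size-ℕ : ∀ k → size ⟦ k ⟧ℕ ≡ 1 + (k + k)
size-ℕ zero    = refl
size-ℕ (suc k) = cong (λ t → 2 + t) (trans (size-ℕ k) (sym (+-suc k k)))

-- In a row, 4 pays for a list cell and an encoded Boolean, which has size at most 3.
graphSize : ℕ → ℕ
graphSize n = 1 + n * (1 + (1 + n * 4))

graphSize-mono : ∀ {m n} → m ≤ n → graphSize m ≤ graphSize n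
graphSize-mono le = s≤s (*-mono-≤ le (s≤s (s≤s (*-monoˡ-≤ 4 le))))

size-Graph : ∀ G → size ⟦ G ⟧Graph ≤ graphSize (order G)
size-Graph G = size-tabulate {order G} _ (λ i → size-tabulate {order G} _ (λ j → size-Bool (Graph.adj G i j)))

n<size-Graph : ∀ G → suc (order G) ≤ size ⟦ G ⟧Graph
n<size-Graph G = n<size-tabulate {order G} _

*-^ : ∀ m n d → (m * n) ^ d ≡ m ^ d * n ^ d
*-^ m n zero    = refl
*-^ m n (suc d) = trans (cong (m * n *_) (*-^ m n d)) ([m*n]*[o*p]≡[m*o]*[n*p] m n (m ^ d) (n ^ d))

-- For n at least 1, `suc n` is at most 2n; the factor 2 ^ d goes into the constant.
bounded⇒polynomial : ∀ {f} → PolynomiallyBounded f →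
  ∃[ c ] ∃[ d ] ∀ {m n} → 1 ≤ n → m ≤ f n → m ≤ c * n ^ d + c
bounded⇒polynomial {f} (c , d , p) = c * 2 ^ d , d , λ {m} {n} 1≤n m≤ → begin
  m                          ≤⟨ ≤-trans m≤ (p n) ⟩
  c * suc n ^ d              ≤⟨ *-monoʳ-≤ c (^-monoˡ-≤ d (+-mono-≤ 1≤n (≤-reflexive (sym (+-identityʳ n))))) ⟩
  c * (2 * n) ^ d            ≡⟨ cong (c *_) (*-^ 2 n d) ⟩
  c * (2 ^ d * n ^ d)        ≡⟨ *-assoc c (2 ^ d) (n ^ d) ⟨
  c * 2 ^ d * n ^ d          ≤⟨ m≤m+n _ _ ⟩
  c * 2 ^ d * n ^ d + c * 2 ^ d ∎
  where open ≤-Reasoning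

-- The fold treats the last index first, so `Φ i` is the state once all indices from i on have been
-- treated, and the induction descends from n to 0.
foldFin-ind : ∀ {a p} {A : Set a} (Φ : ℕ → A → Set p) n (f : Fin n → A → A) z →
  Φ n z → (∀ i x → Φ (suc (toℕ i)) x → Φ (toℕ i) (f i x)) → Φ 0 (foldFin n f z)
foldFin-ind Φ zero    f z base step = base
foldFin-ind Φ (suc n) f z base step =
  step zero _ (foldFin-ind (λ m → Φ (suc m)) n (λ i → f (suc i)) z base (λ i x → step (suc i) x))

foldFin-inv : ∀ {a p} {A : Set a} (Φ : A → Set p) n (f : Fin n → A → A) z →
  Φ z → (∀ i x → Φ x → Φ (f i x)) → Φ (foldFin n f z)
foldFin-inv Φ = foldFin-ind (λ _ → Φ)

minus-≤ : ∀ {n} k (S : Mask n) → k minus S ≤ k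
minus-≤ k S = ≤-trans (≤-reflexive (minus-∣∣ k S)) (m∸n≤m k ∣ S ∣)

reduce-≤ : ∀ {n} (A : Relation n) s → proj₂ (reduce A s) ≤ proj₂ s
reduce-≤ A s with assign A (proj₁ s) (proj₁ (greedy A s))
... | M , nothing = ≤-refl
... | M , just C  = minus-≤ (proj₂ s) (partners A M C)

reduceAll-≤ : ∀ {n} (A : Relation n) k → proj₂ (reduceAll A k) ≤ k
reduceAll-≤ {n} A k = foldFin-inv (λ s → proj₂ s ≤ k) (suc n) (λ _ → reduce A) _ ≤-refl
  (λ _ s le → ≤-trans (reduce-≤ A s) le)

order-kernelOf : ∀ G s → order (proj₁ (kernelOf G s)) ≤ ∣ proj₁ s ∣
order-kernelOf G s
  with proj₂ (greedy (Graph.adj G) s) | proj₂ s minus proj₁ (greedy (Graph.adj G) s)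
... | zero  | _     = z≤n
... | suc _ | zero  = z≤n
... | suc _ | suc _ = ≤-reflexive (length-members (proj₁ s))

parameter-kernelOf : ∀ G s → proj₂ (kernelOf G s) ≤ proj₂ s
parameter-kernelOf G s
  with proj₂ (greedy (Graph.adj G) s) | proj₂ s minus proj₁ (greedy (Graph.adj G) s)
... | zero  | _     = z≤n
... | suc _ | zero  = z≤n
... | suc _ | suc _ = ≤-refl

order-kernelization : ∀ G k → order (proj₁ (kernelization (G , k))) ≤ order G
order-kernelization G k = ≤-trans (order-kernelOf G _) (∣∣≤n (proj₁ (reduceAll (Graph.adj G) k)))

parameter-kernelization : ∀ G k → proj₂ (kernelization (G , k)) ≤ k
parameter-kernelization G k = ≤-trans (parameter-kernelOf G _) (reduceAll-≤ (Graph.adj G) k)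

computed⇒polynomialTime : ∀ {c ℓ} (F : Field c ℓ) (C : Code) →
  (∀ G k → run (order G) C ⟦ G , k ⟧Output ≡ ⟦ kernelization (G , k) ⟧Output) →
  PolynomialTime (DualMinrank F) kernelization
computed⇒polynomialTime F C computes =
  Programs.instanceProgram C , proj₁ poly , proj₁ (proj₂ poly) , λ G k →
    2 + cost (order G) C ⟦ G , k ⟧Output ,
    runs G k ,
    proj₂ (proj₂ poly) (≤-trans (≤-trans (s≤s z≤n) (n<size-Graph G)) (m≤m+n _ k)) (total G k)
  where
  c  = proj₁ (costBound-bounded C)
  d  = proj₁ (proj₂ (costBound-bounded C))
  f : ℕ → ℕ
  -- The first two summands bound the running time, the last the size of the output. The argument
  -- will be the input size, which bounds both the order and the parameter of the kernel.
  f n = 2 + c * suc n ^ d + (1 + (graphSize n + (1 + (n + n))))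
  poly = bounded⇒polynomial {f}
    (+-bounded (+-bounded (const-bounded 2) (c , d , λ _ → ≤-refl))
      (+-bounded (const-bounded 1) (+-bounded
        (+-bounded (const-bounded 1) (*-bounded id-bounded (+-bounded (const-bounded 1)
          (+-bounded (const-bounded 1) (*-bounded id-bounded (const-bounded 4))))))
        (+-bounded (const-bounded 1) (+-bounded id-bounded id-bounded)))))

  runs : ∀ G k → Runs (Programs.instanceProgram C) ⟦ G , k ⟧Output
                   ⟦ kernelization (G , k) ⟧Output (2 + cost (order G) C ⟦ G , k ⟧Output)
  runs G k = subst₂ (Runs _ _)
    (trans (cong (λ n → run n C ⟦ G , k ⟧Output) eq) (computes G k))
    (cong (λ n → 2 + cost n C ⟦ G , k ⟧Output) eq)
    (Programs.instance-runs C ⟦ G ⟧Graph ⟦ k ⟧ℕ)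
    where
    eq : spine ⟦ G ⟧Graph ≡ order G
    eq = spine-List {order G} _

  total : ∀ G k → 2 + cost (order G) C ⟦ G , k ⟧Output + size ⟦ kernelization (G , k) ⟧Output
                ≤ f (size ⟦ G ⟧Graph + k)
  total G k = +-mono-≤
    (+-monoʳ-≤ 2 (≤-trans (cost-≤ (order G) C _)
      (≤-trans (proj₂ (proj₂ (costBound-bounded C)) (order G))
               (*-monoʳ-≤ c (^-monoˡ-≤ d (s≤s n≤N))))))
    (s≤s (+-mono-≤
      (≤-trans (size-Graph G′) (graphSize-mono (≤-trans (order-kernelization G k) n≤N)))
      (≤-trans (≤-reflexive (size-ℕ k′)) (s≤s (+-mono-≤ k′≤N k′≤N)))))
    where
    G′ = proj₁ (kernelization (G , k))
    k′ = proj₂ (kernelization (G , k))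
    n≤N : order G ≤ size ⟦ G ⟧Graph + k
    n≤N = ≤-trans (<⇒≤ (n<size-Graph G)) (m≤m+n _ k)
    k′≤N : k′ ≤ size ⟦ G ⟧Graph + k
    k′≤N = ≤-trans (parameter-kernelization G k) (m≤n+m k _)

-- This is `graphSize (3 * k)`, nested in such a way that two loops over k compute it by adding the
-- constants 6 and 36.
sizeBound : ℕ → ℕ
sizeBound k = 1 + k * (6 + k * 36)

sizeBound-computable : Computable sizeBound
sizeBound-computable = Programs.unaryProgram sizeCode , λ k →
  cost (spine ⟦ k ⟧ℕ) sizeCode ⟦ k ⟧ℕ ,
  subst (λ y → Runs (Programs.unaryProgram sizeCode) ⟦ k ⟧ℕ y (cost (spine ⟦ k ⟧ℕ) sizeCode ⟦ k ⟧ℕ))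
    (run-sizeCode k) (Programs.unary-runs sizeCode ⟦ k ⟧ℕ)
  where
  add : ℕ → Code → Code
  add zero    c = c
  add (suc m) c = pair nil (add m c)

  sizeCode : Code
  sizeCode = loop input (add 1 nil)
    (loop (tl (tl input)) (add 6 (hd (tl input))) (add 36 (hd (tl input))))

  spine-ℕ : ∀ k → spine ⟦ k ⟧ℕ ≡ k
  spine-ℕ zero    = refl
  spine-ℕ (suc k) = cong suc (spine-ℕ k)

  foldFin-+ : ∀ n m z → foldFin n (λ _ → _+_ m) z ≡ z + n * m
  foldFin-+ zero    m z = sym (+-identityʳ z)
  foldFin-+ (suc n) m z = trans (cong (_+_ m) (foldFin-+ n m z)) (+-swap m z (n * m))

  run-sizeCode : ∀ k → run (spine ⟦ k ⟧ℕ) sizeCode ⟦ k ⟧ℕ ≡ ⟦ sizeBound k ⟧ℕ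
  run-sizeCode k rewrite spine-ℕ k = trans
    (iterate-foldFin ⟦_⟧ℕ _ k k (λ _ x → 6 + k * 36 + x) ≤-refl
      (λ i x → trans (iterate-foldFin ⟦_⟧ℕ _ k k (λ _ y → 36 + y) ≤-refl (λ _ _ → refl) (6 + x))
                     (cong ⟦_⟧ℕ (trans (foldFin-+ k 36 (6 + x)) (lemma x (k * 36))))) 1)
    (cong ⟦_⟧ℕ (foldFin-+ k (6 + k * 36) 1))
    where
    lemma : ∀ x p → 6 + x + p ≡ 6 + p + x
    lemma = solve-∀

k≤sizeBound : ∀ k → k ≤ sizeBound k
k≤sizeBound k = m≤n⇒m≤1+n (m≤m*n k (6 + k * 36))

graphSize-≤ : ∀ {n k} → n ≤ 3 * k → graphSize n ≤ sizeBound k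
graphSize-≤ {n} {k} le = ≤-trans (graphSize-mono le) (≤-reflexive (lemma k))
  where
  lemma : ∀ k → 1 + 3 * k * (1 + (1 + 3 * k * 4)) ≡ 1 + k * (6 + k * 36)
  lemma = solve-∀

-- Minrank on a set of vertices

infix 4 _∈_
_∈_ : ∀ {n} → Fin n → Mask n → Set
i ∈ S = S i ≡ true

full : ∀ {n} → Mask n
full _ = true

module LinearAlgebra {c ℓ} (F : Field c ℓ) where

  open Field F using (_≈_; 0#; 1#) renaming (Carrier to K)
  private
    module F = Field F
    module R = SetoidReasoning F.setoid
  open Sum F.semiring using (sum; sum-remove; sum-cong-≋)

  sum-zero : ∀ {r} (x : Fin r → K) → (∀ j → x j ≈ 0#) → sum x ≈ 0#
  sum-zero {zero}  x h = F.refl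
  sum-zero {suc r} x h =
    F.trans (F.+-cong (h zero) (sum-zero (x ∘ suc) (h ∘ suc))) (F.+-identityˡ 0#)

  sum-only : ∀ {r} (x : Fin r → K) l → (∀ j → l ≢ j → x j ≈ 0#) → sum x ≈ x l
  sum-only x zero    h =
    F.trans (F.+-congˡ (sum-zero (x ∘ suc) (λ j → h (suc j) λ ()))) (F.+-identityʳ _)
  sum-only x (suc l) h =
    F.trans (F.+-cong (h zero λ ()) (sum-only (x ∘ suc) l (λ j ne → h (suc j) (λ { refl → ne refl }))))
            (F.+-identityˡ _)

  *-cancel-0 : ∀ {x y} → ¬ y ≈ 0# → x F.* y ≈ 0# → x ≈ 0#
  *-cancel-0 {x} {y} y≉0 xy≈0 = let (z , yz≈1) = F.inverse y y≉0 in R.begin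
    x               R.≈⟨ F.sym (F.*-identityʳ x) ⟩
    x F.* 1#        R.≈⟨ F.*-congˡ (F.sym yz≈1) ⟩
    x F.* (y F.* z) R.≈⟨ F.sym (F.*-assoc x y z) ⟩
    x F.* y F.* z   R.≈⟨ F.*-congʳ xy≈0 ⟩
    0# F.* z        R.≈⟨ F.zeroˡ z ⟩
    0#              R.∎

  module _ {n : ℕ} (S : Mask n) (A : Matrix F n n) where

    IndependentOn : ∀ {r} → (Fin r → Fin n) → Set (c ⊔ ℓ)
    IndependentOn {r} col = ∀ (a : Fin r → K) →
      (∀ i → i ∈ S → sum (λ j → a j F.* A i (col j)) ≈ 0#) → ∀ j → a j ≈ 0#

    -- A bound on the rank of the principal submatrix on `S` that exhibits no maximal independent
    -- set; equality in the field need not be decidable.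
    RankAtMost : ℕ → Set (c ⊔ ℓ)
    RankAtMost s = ∀ r (col : Fin r → Fin n) → (∀ j → col j ∈ S) → IndependentOn col → r ≤ s

    remove-column : ∀ {r} (col : Fin (suc r) → Fin n) j → IndependentOn col →
                    IndependentOn (col ∘ punchIn j)
    remove-column col j ind a h l =
      F.trans (F.reflexive (sym (insertAt-punchIn a j 0# l))) (ind b h′ (punchIn j l))
      where
      b = insertAt a j 0#
      h′ : ∀ i → i ∈ S → sum (λ m → b m F.* A i (col m)) ≈ 0#
      h′ i i∈S = R.begin
        sum (λ m → b m F.* A i (col m))
          R.≈⟨ sum-remove {i = j} (λ m → b m F.* A i (col m)) ⟩
        b j F.* A i (col j) F.+ sum (λ m → b (punchIn j m) F.* A i (col (punchIn j m)))
          R.≈⟨ F.+-cong (F.trans (F.*-congʳ (F.reflexive (insertAt-lookup a j 0#))) (F.zeroˡ _))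
                        (F.trans (sum-cong-≋ (λ m → F.*-congʳ (F.reflexive (insertAt-punchIn a j 0# m)))) (h i i∈S)) ⟩
        0# F.+ 0# R.≈⟨ F.+-identityˡ 0# ⟩
        0# R.∎

    -- The coefficients 1 at `j` and -1 at the other column give a relation, which would force 1 =
    -- 0.
    independent-distinct : ∀ {r} (col : Fin (suc r) → Fin n) j l → IndependentOn col →
      ¬ (∀ i → i ∈ S → A i (col j) ≈ A i (col (punchIn j l)))
    independent-distinct {r} col j l ind eq =
      F.0≉1 (F.sym (F.trans (F.reflexive (sym (insertAt-lookup b j 1#))) (ind a h j)))
      where
      b : Fin r → K
      b m = if does (l ≟ m) then F.- 1# else 0#
      a = insertAt b j 1#
      b-l : b l ≡ F.- 1#
      b-l with l ≟ l
      ... | yes _ = refl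
      ... | no ne = ⊥-elim (ne refl)
      b-other : ∀ m → l ≢ m → b m ≡ 0#
      b-other m ne with l ≟ m
      ... | yes eq = ⊥-elim (ne eq)
      ... | no _   = refl
      h : ∀ i → i ∈ S → sum (λ m → a m F.* A i (col m)) ≈ 0#
      h i i∈S = R.begin
        sum (λ m → a m F.* A i (col m))
          R.≈⟨ sum-remove {i = j} (λ m → a m F.* A i (col m)) ⟩
        a j F.* x F.+ sum (λ m → a (punchIn j m) F.* A i (col (punchIn j m)))
          R.≈⟨ F.+-cong (F.trans (F.*-congʳ (F.reflexive (insertAt-lookup b j 1#))) (F.*-identityˡ x))
               (F.trans (sum-cong-≋ (λ m → F.*-congʳ (F.reflexive (insertAt-punchIn b j 1# m))))
               (F.trans (sum-only _ l (λ m ne → F.trans (F.*-congʳ (F.reflexive (b-other m ne))) (F.zeroˡ _)))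
                        (F.*-congʳ (F.reflexive b-l)))) ⟩
        x F.+ F.- 1# F.* A i (col (punchIn j l))
          R.≈⟨ F.+-congˡ (F.trans (RingProperties.-1*x≈-x F.ring _) (F.-‿cong (F.sym (eq i i∈S)))) ⟩
        x F.+ F.- x R.≈⟨ F.-‿inverseʳ x ⟩
        0# R.∎
        where x = A i (col j)

    independent⇒injective : ∀ {r} (col : Fin r → Fin n) → IndependentOn col →
                            ∀ {j k} → col j ≡ col k → j ≡ k
    independent⇒injective {suc r} col ind {j} {k} eq with j ≟ k
    ... | yes j≡k = j≡k
    ... | no  j≢k = ⊥-elim (independent-distinct col j (punchOut j≢k) ind
      (λ i _ → F.reflexive (cong (A i) (trans eq (cong col (sym (punchIn-punchOut j≢k)))))))

    -- Distinctness of the columns already gives this crude bound, and it is all that the existence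
    -- of a maximum requires; no elimination is carried out.
    independent⇒≤ : ∀ {r} (col : Fin r → Fin n) → IndependentOn col → r ≤ n
    independent⇒≤ col ind = injective⇒≤ {f = col} (independent⇒injective col ind)

  module _ (G : Graph) where
    open Graph G using (adj; irrefl) renaming (order to n)

    RepresentsOn : Mask n → Matrix F n n → Set ℓ
    RepresentsOn S A =
      (∀ i → i ∈ S → ¬ A i i ≈ 0#) ×
      (∀ i j → i ∈ S → j ∈ S → i ≢ j → adj i j ≡ false → A i j ≈ 0#)

    MinrankAtMost : Mask n → ℕ → Set (c ⊔ ℓ)
    MinrankAtMost S s = ∃[ A ] RepresentsOn S A × RankAtMost S A s

    minrank-empty : ∀ {S} → (∀ i → S i ≡ false) → MinrankAtMost S 0
    minrank-empty {S} h = (λ _ _ → 0#) , ((λ i → absurd i) , (λ i j → absurd i)) , rank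
      where
      absurd : ∀ {a} {X : Set a} i → i ∈ S → X
      absurd i i∈S with () ← trans (sym i∈S) (h i)
      rank : RankAtMost S (λ _ _ → 0#) 0
      rank zero    col mem ind = z≤n
      rank (suc r) col mem ind = absurd (col zero) (mem zero)

    minrank-mono : ∀ {S T s} → (∀ i → i ∈ T → i ∈ S) → MinrankAtMost S s → MinrankAtMost T s
    minrank-mono T⊆S (A , (diag , off) , rank) =
      A , ((λ i i∈T → diag i (T⊆S i i∈T)) , (λ i j i∈T j∈T → off i j (T⊆S i i∈T) (T⊆S j j∈T))) ,
      (λ r col mem ind → rank r col (λ j → T⊆S _ (mem j)) (λ a h → ind a (λ i i∈T → h i (T⊆S i i∈T))))

    -- An all-one block on a clique B raises the rank by at most one, since its
    -- columns coincide.
    minrank-clique : ∀ {S T B s} → (∀ i → i ∈ T → i ∈ S ⊎ i ∈ B) →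
      (∀ i j → i ∈ B → j ∈ B → i ≢ j → adj i j ≡ true) →
      MinrankAtMost S s → MinrankAtMost T (suc s)
    minrank-clique {S} {T} {B} {s} T⊆S∪B clique (A , (diag , off) , rank) = A′ , (diag′ , off′) , rank′
      where
      A′ : Matrix F n n
      A′ i j = if B i then (if B j then 1# else 0#) else (if B j then 0# else A i j)

      T⊆S : ∀ i → i ∈ T → B i ≡ false → i ∈ S
      T⊆S i i∈T i∉B with T⊆S∪B i i∈T
      ... | inj₁ i∈S = i∈S
      ... | inj₂ i∈B with () ← trans (sym i∈B) i∉B

      diag′ : ∀ i → i ∈ T → ¬ A′ i i ≈ 0#
      diag′ i i∈T with B i in eq
      ... | true  = λ 1≈0 → F.0≉1 (F.sym 1≈0)
      ... | false = diag i (T⊆S i i∈T eq)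

      off′ : ∀ i j → i ∈ T → j ∈ T → i ≢ j → adj i j ≡ false → A′ i j ≈ 0#
      off′ i j i∈T j∈T i≢j ij∉E with B i in p | B j in q
      ... | true  | true  with () ← trans (sym (clique i j p q i≢j)) ij∉E
      ... | true  | false = F.refl
      ... | false | true  = F.refl
      ... | false | false = off i j (T⊆S i i∈T p) (T⊆S j j∈T q) i≢j ij∉E

      A′-block : ∀ i j k → B j ≡ true → B k ≡ true → A′ i j ≡ A′ i k
      A′-block i j k p q rewrite p | q = refl

      restrict : ∀ r (col : Fin r → Fin n) → (∀ j → B (col j) ≡ false) →
                 IndependentOn T A′ col → IndependentOn S A col
      restrict r col out ind a h = ind a h′
        where
        h′ : ∀ i → i ∈ T → sum (λ j → a j F.* A′ i (col j)) ≈ 0#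
        h′ i i∈T with B i in p
        ... | true  = sum-zero _ λ j → F.trans (F.*-congˡ (F.reflexive
                        (cong (λ b → if b then 1# else 0#) (out j)))) (F.zeroʳ _)
        ... | false = F.trans (sum-cong-≋ λ j → F.*-congˡ (F.reflexive
                        (cong (λ b → if b then 0# else A i (col j)) (out j)))) (h i (T⊆S i i∈T p))

      rank′ : RankAtMost T A′ (suc s)
      rank′ r col mem ind with any? (λ j → B (col j) Bool.≟ true)
      ... | no none = m≤n⇒m≤1+n (rank r col (λ j → T⊆S _ (mem j) (out j)) (restrict r col out ind))
        where
        out : ∀ j → B (col j) ≡ false
        out j = Bool.¬-not (λ p → none (j , p))
      rank′ (suc r) col mem ind | yes (j , j∈B) =
        s≤s (rank r col′ (λ l → T⊆S _ (mem (punchIn j l)) (out l))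
              (restrict r col′ out (remove-column T A′ col j ind)))
        where
        col′ = col ∘ punchIn j
        out : ∀ l → B (col′ l) ≡ false
        out l = Bool.¬-not (λ p → independent-distinct T A′ col j l ind
          (λ i _ → F.reflexive (A′-block i (col j) (col′ l) j∈B p)))

    -- Row v of A vanishes on S except at the diagonal, so reading a relation in that row kills the
    -- coefficient of column v. Hence column v can be added to any independent columns of T, and
    -- ranks on T stay below s. Adding it to the empty family shows that s is positive.
    minrank-isolated : ∀ {S T s} v → v ∈ S → (∀ i → i ∈ T → i ∈ S × v ≢ i) →
      (∀ i → i ∈ S → v ≢ i → i ∈ T) → (∀ i → i ∈ S → adj v i ≡ false) →
      MinrankAtMost S s → ∃[ s′ ] s ≡ suc s′ × MinrankAtMost T s′
    minrank-isolated {S} {T} {s} v v∈S T⊆S S⊆T isolated (A , (diag , off) , rank) =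
      pred s , s≡ , A ,
      ((λ i i∈T → diag i (proj₁ (T⊆S i i∈T))) ,
       (λ i j i∈T j∈T → off i j (proj₁ (T⊆S i i∈T)) (proj₁ (T⊆S j j∈T)))) ,
      λ r col mem ind → s≤s⁻¹ (≤-trans (extended r col mem ind) (≤-reflexive s≡))
      where
      extended : ∀ r col → (∀ j → col j ∈ T) → IndependentOn T A {r} col → suc r ≤ s
      extended r col mem ind = rank (suc r) col⁺ mem⁺ ind⁺
        where
        col⁺ : Fin (suc r) → Fin n
        col⁺ zero    = v
        col⁺ (suc j) = col j
        mem⁺ : ∀ j → col⁺ j ∈ S
        mem⁺ zero    = v∈S
        mem⁺ (suc j) = proj₁ (T⊆S _ (mem j))
        ind⁺ : IndependentOn S A col⁺
        ind⁺ a h = λ { zero → a₀≈0 ; (suc j) → ind (a ∘ suc) h′ j }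
          where
          a₀≈0 : a zero ≈ 0#
          a₀≈0 = *-cancel-0 (diag v v∈S) (F.trans (F.sym (F.trans
            (F.+-congˡ (sum-zero _ λ j → let (p , v≢) = T⊆S _ (mem j) in
              F.trans (F.*-congˡ (off v (col j) v∈S p v≢ (isolated (col j) p))) (F.zeroʳ _)))
            (F.+-identityʳ _))) (h v v∈S))
          h′ : ∀ i → i ∈ T → sum (λ j → a (suc j) F.* A i (col j)) ≈ 0#
          h′ i i∈T = F.trans (F.sym (F.trans (F.+-congʳ (F.trans (F.*-congʳ a₀≈0) (F.zeroˡ _)))
            (F.+-identityˡ _))) (h i (proj₁ (T⊆S i i∈T)))

      s≡ : s ≡ suc (pred s)
      s≡ = sym (suc-pred s {{>-nonZero (extended 0 (λ ()) (λ ()) (λ _ _ ()))}})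

    -- An upper bound replaces the minimum, and a sum replaces the possibly negative difference.
    Saves : Mask n → ℕ → Set (c ⊔ ℓ)
    Saves S k = ∃[ s ] MinrankAtMost S s × s + k ≤ ∣ S ∣

  module _ (em : ExcludedMiddle (c ⊔ ℓ)) where

    maximum : ∀ (P : ℕ → Set (c ⊔ ℓ)) b → P 0 → (∀ s → P s → s ≤ b) → ∃[ r ] IsMaximum P r
    maximum P b P0 bound with em {P b}
    ... | yes Pb = b , Pb , bound
    maximum P zero    P0 bound | no ¬Pb = ⊥-elim (¬Pb P0)
    maximum P (suc b) P0 bound | no ¬Pb = maximum P b P0 λ s Ps →
      s≤s⁻¹ (≤∧≢⇒< (bound s Ps) (λ { refl → ¬Pb Ps }))

    minimum : ∀ (P : ℕ → Set (c ⊔ ℓ)) r → P r → ∃[ m ] IsMinimum P m × m ≤ r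
    minimum P r = <-rec (λ r → P r → ∃[ m ] IsMinimum P m × m ≤ r) step r
      where
      step : ∀ r → (∀ {s} → s < r → P s → ∃[ m ] IsMinimum P m × m ≤ s) →
             P r → ∃[ m ] IsMinimum P m × m ≤ r
      step r rec Pr with em {∃[ s ] s < r × P s}
      ... | yes (s , s<r , Ps) = let (m , isMin , m≤s) = rec s<r Ps in m , isMin , ≤-trans m≤s (<⇒≤ s<r)
      ... | no none = r , (Pr , λ s Ps → ≮⇒≥ (λ s<r → none (s , s<r , Ps))) , ≤-refl

    -- From left to right, minimality is forgotten. Conversely, excluded middle provides the rank of
    -- the given matrix and then the least rank of a representing matrix, both at most `s`.
    Yes⇔Saves : ∀ G k → ParameterizedProblem.Yes (DualMinrank F) G k ⇔ Saves G full k
    Yes⇔Saves G k = mk⇔ to from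
      where
      open Graph G using (adj; irrefl) renaming (order to n)
      to : ParameterizedProblem.Yes (DualMinrank F) G k → Saves G full k
      to (r , ((A , (diag , off) , (_ , rank)) , _) , le) =
        r , (A , ((λ i _ → diag i) , (λ i j _ _ i≢j e → off i j i≢j (subst (λ b → ¬ T b) (sym e) λ ()))) ,
             (λ s col _ ind → rank s (col , λ a h → ind a (λ i _ → h i)))) ,
        ≤-trans (drop-≤ r k n le) (≤-reflexive (sym (∣true∣ n)))
        where
        drop-≤ : ∀ r k n → + r ℤ.≤ + n ℤ.- + k → r + k ≤ n
        drop-≤ r k n le = ℤ.drop‿+≤+ (subst (+ (r + k) ℤ.≤_) (cancel (+ n) (+ k)) (ℤ.+-monoˡ-≤ (+ k) le))
          where
          cancel : ∀ x y → (x ℤ.- y) ℤ.+ y ≡ x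
          cancel x y = trans (ℤ.+-assoc x (ℤ.- y) y)
                      (trans (cong (λ z → x ℤ.+ z) (ℤ.+-inverseˡ y)) (ℤ.+-identityʳ x))
      from : Saves G full k → ParameterizedProblem.Yes (DualMinrank F) G k
      from (s , (A , (diag , off) , rank) , le) =
        let (r , (r-col , r-max)) = maximum (HasIndependentColumns F A) n ((λ ()) , λ _ _ ())
              (λ r (col , ind) → independent⇒≤ full A col (λ a h → ind a (λ i → h i refl)))
            r≤s = rank r (proj₁ r-col) (λ _ → refl) (λ a h → proj₂ r-col a (λ i → h i refl))
            rep = (λ i → diag i refl) , (λ i j i≢j ¬e → off i j refl refl i≢j (¬T⇒false _ ¬e))
            (m , isMin , m≤r) = minimum (λ r → ∃[ A ] Represents F G A × IsRank F A r) r
                                  (A , rep , r-col , r-max)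
            m+k≤n = ≤-trans (+-monoˡ-≤ k (≤-trans m≤r r≤s)) (≤-trans le (≤-reflexive (∣true∣ n)))
        in m , isMin , ≤-⊖ m k n m+k≤n
        where
        ¬T⇒false : ∀ b → ¬ T b → b ≡ false
        ¬T⇒false true  ¬t = ⊥-elim (¬t _)
        ¬T⇒false false ¬t = refl
        ≤-⊖ : ∀ m k n → m + k ≤ n → + m ℤ.≤ + n ℤ.- + k
        ≤-⊖ m k n le = subst (ℤ._≤ + n ℤ.- + k) (cancel (+ m) (+ k)) (ℤ.+-monoˡ-≤ (ℤ.- + k) (ℤ.+≤+ le))
          where
          cancel : ∀ x y → (x ℤ.+ y) ℤ.- y ≡ x
          cancel x y = trans (ℤ.+-assoc x y (ℤ.- y))
                      (trans (cong (λ z → x ℤ.+ z) (ℤ.+-inverseʳ y)) (ℤ.+-identityʳ x))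

  -- Matrices are carried along the bijection between positions in `members S` and elements of S,
  -- and padded with zeros outside S. A position depends on a membership proof, but such proofs are
  -- unique.
  Saves-induced : ∀ G S k → Saves (induced G S) full k ⇔ Saves G S k
  Saves-induced G S k = mk⇔ to from
    where
    open Graph G using (adj) renaming (order to n)
    L  = members S
    n′ = length L

    vertex : Fin n′ → Fin n
    vertex = List.lookup L

    vertex∈S : ∀ p → vertex p ∈ S
    vertex∈S p = Equivalence.to Bool.T-≡ (proj₂ (∈-filter⁻ (λ i → T? (S i)) {xs = allFin n} (∈-lookup p)))

    vertex-injective : ∀ {p q} → vertex p ≡ vertex q → p ≡ q
    vertex-injective = unique-lookup (Unique.filter⁺ (λ i → T? (S i)) (Unique.allFin⁺ n))
      where
      unique-lookup : ∀ {xs : List (Fin n)} → Unique.Unique xs →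
                      ∀ {p q} → List.lookup xs p ≡ List.lookup xs q → p ≡ q
      unique-lookup (x∉ ∷ u) {zero}  {zero}  eq = refl
      unique-lookup (x∉ ∷ u) {zero}  {suc q} eq = ⊥-elim (All.lookup x∉ (∈-lookup q) eq)
      unique-lookup (x∉ ∷ u) {suc p} {zero}  eq = ⊥-elim (All.lookup x∉ (∈-lookup p) (sym eq))
      unique-lookup (x∉ ∷ u) {suc p} {suc q} eq = cong suc (unique-lookup u eq)

    position : ∀ i → i ∈ S → Fin n′
    position i i∈S = Any.index (∈-filter⁺ (λ i → T? (S i)) (∈-allFin i) (Equivalence.from Bool.T-≡ i∈S))

    vertex-position : ∀ i i∈S → vertex (position i i∈S) ≡ i
    vertex-position i i∈S = sym (lookup-index (∈-filter⁺ (λ i → T? (S i)) (∈-allFin i) (Equivalence.from Bool.T-≡ i∈S)))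

    count : ∣ full {n′} ∣ ≡ ∣ S ∣
    count = trans (∣true∣ n′) (length-members S)

    from : Saves G S k → Saves (induced G S) full k
    from (s , (A , (diag , off) , rank) , le) =
      s , ((λ p q → A (vertex p) (vertex q)) ,
           ((λ p _ → diag _ (vertex∈S p)) ,
            (λ p q _ _ p≢q → off _ _ (vertex∈S p) (vertex∈S q) (p≢q ∘ vertex-injective))) ,
           λ r col _ ind → rank r (vertex ∘ col) (vertex∈S ∘ col) (λ a h →
             ind a (λ p _ → h (vertex p) (vertex∈S p)))) ,
      ≤-trans le (≤-reflexive (sym count))

    to : Saves (induced G S) full k → Saves G S k
    to (s , (A′ , (diag , off) , rank) , le) =
      s , (A , (diag′ , off′) , rank′) , ≤-trans le (≤-reflexive count)
      where
      entry : ∀ {i j} → Dec (i ∈ S) → Dec (j ∈ S) → K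
      entry (yes p) (yes q) = A′ (position _ p) (position _ q)
      entry _       _       = 0#

      A : Matrix F n n
      A i j = entry (S i Bool.≟ true) (S j Bool.≟ true)

      A≡A′ : ∀ {i j} (p : i ∈ S) (q : j ∈ S) → A i j ≡ A′ (position i p) (position j q)
      A≡A′ {i} {j} p q = cong₂ entry (dec-yes-irr (S i Bool.≟ true) uip p) (dec-yes-irr (S j Bool.≟ true) uip q)

      diag′ : ∀ i → i ∈ S → ¬ A i i ≈ 0#
      diag′ i i∈S eq = diag (position i i∈S) refl (F.trans (F.reflexive (sym (A≡A′ i∈S i∈S))) eq)

      off′ : ∀ i j → i ∈ S → j ∈ S → i ≢ j → adj i j ≡ false → A i j ≈ 0#
      off′ i j p q i≢j e = F.trans (F.reflexive (A≡A′ p q))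
        (off _ _ refl refl
          (λ eq → i≢j (trans (sym (vertex-position i p)) (trans (cong vertex eq) (vertex-position j q))))
          (trans (cong₂ adj (vertex-position i p) (vertex-position j q)) e))

      rank′ : RankAtMost S A s
      rank′ r col mem ind = rank r (λ j → position (col j) (mem j)) (λ _ → refl) λ a h →
        ind a (λ i i∈S → F.trans (sum-cong-≋ (λ j → F.*-congˡ (F.reflexive (A≡A′ i∈S (mem j)))))
                                 (h (position i i∈S) refl))

-- Updates, inclusions and cardinalities of masks

true≢false : ∀ {a} {X : Set a} {b} → b ≡ true → b ≡ false → X
true≢false refl ()

update-same : ∀ {n} {X : Set} (v : Fin n → X) i x → (v [ i ≔ x ]) i ≡ x
update-same v i x with i ≟ i
... | yes _ = refl
... | no ne = ⊥-elim (ne refl)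

update-other : ∀ {n} {X : Set} (v : Fin n → X) {i j} x → i ≢ j → (v [ i ≔ x ]) j ≡ v j
update-other v {i} {j} x ne with i ≟ j
... | yes eq = ⊥-elim (ne eq)
... | no _   = refl

-- The balanced form avoids subtraction; insertion and removal are its two instances.
∣∣-update : ∀ {n} (S : Mask n) i b → ⟨ S i ⟩ + ∣ S [ i ≔ b ] ∣ ≡ ⟨ b ⟩ + ∣ S ∣
∣∣-update S zero    b = +-swap ⟨ S zero ⟩ ⟨ b ⟩ ∣ S ∘ suc ∣
∣∣-update S (suc i) b = begin
  ⟨ S (suc i) ⟩ + (⟨ S zero ⟩ + ∣ (S ∘ suc) [ i ≔ b ] ∣) ≡⟨ +-swap ⟨ S (suc i) ⟩ ⟨ S zero ⟩ _ ⟩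
  ⟨ S zero ⟩ + (⟨ S (suc i) ⟩ + ∣ (S ∘ suc) [ i ≔ b ] ∣) ≡⟨ cong (_+_ ⟨ S zero ⟩) (∣∣-update (S ∘ suc) i b) ⟩
  ⟨ S zero ⟩ + (⟨ b ⟩ + ∣ S ∘ suc ∣)                     ≡⟨ +-swap ⟨ S zero ⟩ ⟨ b ⟩ _ ⟩
  ⟨ b ⟩ + ∣ S ∣ ∎
  where
  open ≡-Reasoning

∣∣-insert : ∀ {n} (S : Mask n) {i} → S i ≡ false → ∣ S [ i ≔ true ] ∣ ≡ suc ∣ S ∣
∣∣-insert S {i} i∉S = trans (cong (λ b → ⟨ b ⟩ + ∣ S [ i ≔ true ] ∣) (sym i∉S)) (∣∣-update S i true)

∣∣-remove : ∀ {n} (S : Mask n) {i} → i ∈ S → suc ∣ S [ i ≔ false ] ∣ ≡ ∣ S ∣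
∣∣-remove S {i} i∈S = trans (cong (λ b → ⟨ b ⟩ + ∣ S [ i ≔ false ] ∣) (sym i∈S)) (∣∣-update S i false)

infix 4 _⊆_
_⊆_ : ∀ {n} → Mask n → Mask n → Set
S ⊆ T = ∀ i → i ∈ S → i ∈ T

∣∣-mono : ∀ {n} {S T : Mask n} → S ⊆ T → ∣ S ∣ ≤ ∣ T ∣
∣∣-mono {zero}  h = z≤n
∣∣-mono {suc n} {S} {T} h = +-mono-≤ (head (h zero)) (∣∣-mono (λ i → h (suc i)))
  where
  head : ∀ {a b} → (a ≡ true → b ≡ true) → ⟨ a ⟩ ≤ ⟨ b ⟩
  head {false} h = z≤n
  head {true}  h rewrite h refl = ≤-refl

remove-⊆ : ∀ {n} (S : Mask n) i → S [ i ≔ false ] ⊆ S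
remove-⊆ S i j p with i ≟ j
... | no _ = p

∈-remove : ∀ {n} (S : Mask n) {i j} → i ≢ j → j ∈ S → j ∈ S [ i ≔ false ]
∈-remove S ne j∈S = trans (update-other S false ne) j∈S

remove-≢ : ∀ {n} (S : Mask n) {i j} → j ∈ S [ i ≔ false ] → i ≢ j
remove-≢ S {i} p refl = true≢false p (update-same S i false)

insert-cases : ∀ {n} (S : Mask n) i j → j ∈ S [ i ≔ true ] → j ∈ S ⊎ i ≡ j
insert-cases S i j p with i ≟ j
... | yes eq = inj₂ eq
... | no _   = inj₁ p

⊆-insert : ∀ {n} (S : Mask n) i → S ⊆ S [ i ≔ true ]
⊆-insert S i j j∈S with i ≟ j
... | yes _ = refl
... | no _  = j∈S

∣∣-strict : ∀ {n} {S T : Mask n} → S ⊆ T → ∀ i → i ∈ T → S i ≡ false → ∣ S ∣ < ∣ T ∣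
∣∣-strict {S = S} {T} S⊆T i i∈T i∉S = ≤-trans (≤-reflexive (sym (∣∣-insert S i∉S)))
  (∣∣-mono λ j p → [ S⊆T j , (λ { refl → i∈T }) ]′ (insert-cases S i j p))

⊆-∣∣ : ∀ {n} {S T : Mask n} → S ⊆ T → ∣ T ∣ ≤ ∣ S ∣ → T ⊆ S
⊆-∣∣ {S = S} S⊆T le i i∈T with S i in eq
... | true  = refl
... | false = ⊥-elim (<⇒≱ (∣∣-strict S⊆T i i∈T eq) le)

infixl 6 _∖_
_∖_ : ∀ {n} → Mask n → Mask n → Mask n
(S ∖ T) i = if T i then false else S i

∈-∖⁻ : ∀ {n} (S T : Mask n) {i} → i ∈ S ∖ T → i ∈ S × T i ≡ false
∈-∖⁻ S T {i} p with T i
... | false = p , refl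

∈-∖⁺ : ∀ {n} (S T : Mask n) {i} → i ∈ S → T i ≡ false → i ∈ S ∖ T
∈-∖⁺ S T i∈S i∉T rewrite i∉T = i∈S

∉-∖⁺ : ∀ {n} (S T : Mask n) {i} → i ∈ T → (S ∖ T) i ≡ false
∉-∖⁺ S T i∈T rewrite i∈T = refl

∣∣-∖ : ∀ {n} (S T : Mask n) → T ⊆ S → ∣ S ∣ ≡ ∣ S ∖ T ∣ + ∣ T ∣
∣∣-∖ S T T⊆S = ∣∣-partition S (S ∖ T) T split
  where
  split : ∀ i → ⟨ S i ⟩ ≡ ⟨ (S ∖ T) i ⟩ + ⟨ T i ⟩
  split i with T i in eq
  ... | true  = cong ⟨_⟩ (T⊆S i eq)
  ... | false = sym (+-identityʳ _)

∉∅⇒∣∣≡0 : ∀ {n} {S : Mask n} → (∀ i → S i ≡ false) → ∣ S ∣ ≡ 0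
∉∅⇒∣∣≡0 {zero}  h = refl
∉∅⇒∣∣≡0 {suc n} h rewrite h zero = ∉∅⇒∣∣≡0 (h ∘ suc)

∅ : ∀ {n} → Mask n
∅ _ = false

-- Crowns

module Savings {c ℓ} (F : Field c ℓ) (G : Graph) where

  open LinearAlgebra F
  open Graph G using (adj; irrefl) renaming (order to n; sym to adj-sym)

  Saves-weaken : ∀ {S k l} → l ≤ k → Saves G S k → Saves G S l
  Saves-weaken l≤k (s , m , le) = s , m , ≤-trans (+-monoʳ-≤ s l≤k) le

  Saves-cong : ∀ {S T k} → S ⊆ T → T ⊆ S → Saves G S k → Saves G T k
  Saves-cong S⊆T T⊆S (s , m , le) = s , minrank-mono G T⊆S m , ≤-trans le (∣∣-mono S⊆T)

  Saves-∅ : Saves G ∅ 0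
  Saves-∅ = 0 , minrank-empty G (λ _ → refl) , z≤n

  adj-≢ : ∀ {i j} → adj i j ≡ true → i ≢ j
  adj-≢ {i} e refl = true≢false e (irrefl i)

  pairClique : ∀ i j → i ≡ j ⊎ adj i j ≡ true →
    ∀ x y → x ∈ ∅ [ i ≔ true ] [ j ≔ true ] → y ∈ ∅ [ i ≔ true ] [ j ≔ true ] → x ≢ y → adj x y ≡ true
  pairClique i j e x y p q x≢y with cases x p | cases y q
    where
    cases : ∀ x → x ∈ ∅ [ i ≔ true ] [ j ≔ true ] → i ≡ x ⊎ j ≡ x
    cases x p with insert-cases (∅ [ i ≔ true ]) j x p
    ... | inj₂ eq = inj₂ eq
    ... | inj₁ p′ with insert-cases ∅ i x p′
    ... | inj₂ eq = inj₁ eq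
  pairClique i j e x y p q x≢y | inj₁ refl | inj₁ refl = ⊥-elim (x≢y refl)
  pairClique i j e x y p q x≢y | inj₂ refl | inj₂ refl = ⊥-elim (x≢y refl)
  pairClique i j (inj₁ refl) x y p q x≢y | inj₁ refl | inj₂ refl = ⊥-elim (x≢y refl)
  pairClique i j (inj₂ e)    x y p q x≢y | inj₁ refl | inj₂ refl = e
  pairClique i j (inj₁ refl) x y p q x≢y | inj₂ refl | inj₁ refl = ⊥-elim (x≢y refl)
  pairClique i j (inj₂ e)    x y p q x≢y | inj₂ refl | inj₁ refl = trans (adj-sym x y) e

  -- Allowing i = j lets a single vertex and an edge be treated as one kind of clique.
  minrank-pair : ∀ {S T s i j} → i ≡ j ⊎ adj i j ≡ true →
    (∀ x → x ∈ T → x ∈ S ⊎ i ≡ x ⊎ j ≡ x) → MinrankAtMost G S s → MinrankAtMost G T (suc s)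
  minrank-pair {S} {T} {s} {i} {j} e cover = minrank-clique G cover′ (pairClique i j e)
    where
    cover′ : ∀ x → x ∈ T → x ∈ S ⊎ x ∈ ∅ [ i ≔ true ] [ j ≔ true ]
    cover′ x x∈T with cover x x∈T
    ... | inj₁ x∈S         = inj₁ x∈S
    ... | inj₂ (inj₂ refl) = inj₂ (update-same (∅ [ i ≔ true ]) j true)
    ... | inj₂ (inj₁ refl) = inj₂ (⊆-insert (∅ [ i ≔ true ]) j i (update-same ∅ i true))

  Saves-insert : ∀ {S k v} → S v ≡ false → Saves G S k → Saves G (S [ v ≔ true ]) k
  Saves-insert {S} {k} {v} v∉S (s , m , le) =
    suc s , minrank-pair {i = v} {v} (inj₁ refl)
      (λ x p → [ inj₁ , inj₂ ∘ inj₁ ]′ (insert-cases S v x p)) m ,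
    ≤-trans (s≤s le) (≤-reflexive (sym (∣∣-insert S v∉S)))

  -- An edge is a clique: two more vertices for at most one more unit of rank.
  Saves-insertPair : ∀ {S k i j} → S i ≡ false → S j ≡ false → adj i j ≡ true →
    Saves G S k → Saves G (S [ i ≔ true ] [ j ≔ true ]) (suc k)
  Saves-insertPair {S} {k} {i} {j} i∉S j∉S e (s , m , le) =
    suc s , minrank-pair (inj₂ e) cover m ,
    (begin
      suc s + suc k                   ≡⟨ cong suc (+-suc s k) ⟩
      suc (suc (s + k))               ≤⟨ s≤s (s≤s le) ⟩
      suc (suc ∣ S ∣)                 ≡⟨ cong suc (∣∣-insert S i∉S) ⟨
      suc ∣ S [ i ≔ true ] ∣          ≡⟨ ∣∣-insert (S [ i ≔ true ]) (trans (update-other S true (adj-≢ e)) j∉S) ⟨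
      ∣ S [ i ≔ true ] [ j ≔ true ] ∣ ∎)
    where
    open ≤-Reasoning
    cover : ∀ x → x ∈ S [ i ≔ true ] [ j ≔ true ] → x ∈ S ⊎ i ≡ x ⊎ j ≡ x
    cover x p with insert-cases (S [ i ≔ true ]) j x p
    ... | inj₂ eq = inj₂ (inj₂ eq)
    ... | inj₁ p′ = [ inj₁ , inj₂ ∘ inj₁ ]′ (insert-cases S i x p′)

  private
    missing? : ∀ (S T : Mask n) → Dec (∃[ x ] x ∈ S × T x ≡ false)
    missing? S T = any? (λ x → (S x Bool.≟ true) ×-dec (T x Bool.≟ false))

    none⇒⊆ : ∀ {S T : Mask n} → ¬ (∃[ x ] x ∈ S × T x ≡ false) → S ⊆ T
    none⇒⊆ none i i∈S = Bool.¬-not (λ i∉T → none (i , i∈S , i∉T))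

  Saves-grow : ∀ {S T k} → T ⊆ S → Saves G T k → Saves G S k
  Saves-grow {S} {T} T⊆S = go ∣ S ∣ T (m≤n+m ∣ S ∣ ∣ T ∣) T⊆S
    where
    go : ∀ m T → ∣ S ∣ ≤ ∣ T ∣ + m → T ⊆ S → ∀ {k} → Saves G T k → Saves G S k
    go m T le T⊆S saves with missing? S T
    ... | no none = Saves-cong T⊆S (none⇒⊆ none) saves
    go zero    T le T⊆S saves | yes (x , x∈S , x∉T) =
      Saves-cong T⊆S (⊆-∣∣ T⊆S (≤-trans le (≤-reflexive (+-identityʳ _)))) saves
    go (suc m) T le T⊆S saves | yes (x , x∈S , x∉T) =
      go m (T [ x ≔ true ])
        (≤-trans le (≤-reflexive (trans (+-suc ∣ T ∣ m) (cong (_+ m) (sym (∣∣-insert T x∉T))))))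
        (λ i p → [ T⊆S i , (λ { refl → x∈S }) ]′ (insert-cases T x i p))
        (Saves-insert x∉T saves)

  Saves-0 : ∀ S → Saves G S 0
  Saves-0 S = Saves-grow (λ _ ()) Saves-∅

  -- The edges are inserted one at a time; their disjointness follows from injectivity and from
  -- partners lying outside H. The partner relation is abstract because `Mate` is used in both
  -- directions: H is the head of a crown in one use and the independent set in the other.
  Saves-matching : ∀ {S T k} H (P : Fin n → Fin n → Set) → T ⊆ S →
    (∀ h → h ∈ H → h ∈ S × T h ≡ false ×
       ∃[ c ] P h c × c ∈ S × T c ≡ false × H c ≡ false × adj h c ≡ true) →
    (∀ {g h c} → P g c → P h c → g ≡ h) →
    Saves G T k → Saves G S (k + ∣ H ∣)
  Saves-matching {S} {T} H P T⊆S mates inj = go ∣ H ∣ T H refl T⊆S mates inj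
    where
    go : ∀ m T H → ∣ H ∣ ≡ m → T ⊆ S →
      (∀ h → h ∈ H → h ∈ S × T h ≡ false ×
         ∃[ c ] P h c × c ∈ S × T c ≡ false × H c ≡ false × adj h c ≡ true) →
      (∀ {g h c} → P g c → P h c → g ≡ h) →
      ∀ {k} → Saves G T k → Saves G S (k + m)
    go m T H eq T⊆S mates inj saves with missing? H ∅
    go zero    T H eq T⊆S mates inj saves | no none =
      Saves-weaken (≤-reflexive (+-identityʳ _)) (Saves-grow T⊆S saves)
    go (suc m) T H eq T⊆S mates inj saves | no none
      with () ← trans (sym (∉∅⇒∣∣≡0 (λ i → Bool.¬-not (λ i∈H → none (i , i∈H , refl))))) eq
    go zero    T H eq T⊆S mates inj saves | yes (h , h∈H , _)
      with () ← trans (∣∣-remove H h∈H) eq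
    go (suc m) T H eq T⊆S mates inj {k} saves | yes (h , h∈H , _)
      with h∈S , h∉T , c , Phc , c∈S , c∉T , c∉H , e ← mates h h∈H =
      Saves-weaken (≤-reflexive (+-suc k m))
        (go m T′ H′ (suc-injective (trans (∣∣-remove H h∈H) eq)) T′⊆S mates′ inj
          (Saves-insertPair h∉T c∉T e saves))
      where
      T′ H′ : Mask n
      T′ = T [ h ≔ true ] [ c ≔ true ]
      H′ = H [ h ≔ false ]
      T′⊆S : T′ ⊆ S
      T′⊆S x p with insert-cases (T [ h ≔ true ]) c x p
      ... | inj₂ refl = c∈S
      ... | inj₁ p′   = [ T⊆S x , (λ { refl → h∈S }) ]′ (insert-cases T h x p′)
      ∉T′ : ∀ {x} → T x ≡ false → h ≢ x → c ≢ x → T′ x ≡ false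
      ∉T′ x∉T h≢x c≢x =
        trans (update-other (T [ h ≔ true ]) true c≢x) (trans (update-other T true h≢x) x∉T)
      mates′ : ∀ g → g ∈ H′ → g ∈ S × T′ g ≡ false ×
         ∃[ d ] P g d × d ∈ S × T′ d ≡ false × H′ d ≡ false × adj g d ≡ true
      mates′ g g∈H′ with g∈H ← remove-⊆ H h g g∈H′
        with g∈S , g∉T , d , Pgd , d∈S , d∉T , d∉H , e′ ← mates g g∈H =
        g∈S , ∉T′ g∉T h≢g (λ { refl → true≢false g∈H c∉H }) ,
        d , Pgd , d∈S ,
        ∉T′ d∉T (λ { refl → true≢false h∈H d∉H }) (λ { refl → h≢g (inj Phc Pgd) }) ,
        Bool.¬-not (λ p → true≢false (remove-⊆ H h d p) d∉H) , e′
        where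
        h≢g : h ≢ g
        h≢g = remove-≢ H g∈H′

  -- The minrank does not grow while the size drops by ∣ H ∣. If ∣ H ∣ exceeds k, only the trivial
  -- saving 0 is claimed.
  Saves-remove : ∀ {S k} H → H ⊆ S → Saves G S k → Saves G (S ∖ H) (k ∸ ∣ H ∣)
  Saves-remove {S} {k} H H⊆S (s , m , le) with ≤-total ∣ H ∣ k
  ... | inj₂ k≤H = subst (Saves G (S ∖ H)) (sym (m≤n⇒m∸n≡0 k≤H)) (Saves-0 (S ∖ H))
  ... | inj₁ H≤k = s , minrank-mono G (λ i p → proj₁ (∈-∖⁻ S H p)) m ,
    +-cancelʳ-≤ ∣ H ∣ _ _ (begin
      s + (k ∸ ∣ H ∣) + ∣ H ∣   ≡⟨ +-assoc s _ _ ⟩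
      s + (k ∸ ∣ H ∣ + ∣ H ∣)   ≡⟨ cong (_+_ s) (m∸n+n≡m H≤k) ⟩
      s + k                     ≤⟨ le ⟩
      ∣ S ∣                     ≡⟨ ∣∣-∖ S H H⊆S ⟩
      ∣ S ∖ H ∣ + ∣ H ∣ ∎)
    where open ≤-Reasoning

  -- Size and minrank bound both drop by exactly one with each vertex, so nothing of the saving is
  -- lost.
  Saves-removeIsolated : ∀ {S T k} → T ⊆ S →
    (∀ v → v ∈ S → T v ≡ false → ∀ i → i ∈ S → adj v i ≡ false) → Saves G S k → Saves G T k
  Saves-removeIsolated {S} {T} T⊆S isolated = go ∣ S ∣ S (m≤n+m ∣ S ∣ ∣ T ∣) T⊆S isolated
    where
    go : ∀ m S → ∣ S ∣ ≤ ∣ T ∣ + m → T ⊆ S →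
      (∀ v → v ∈ S → T v ≡ false → ∀ i → i ∈ S → adj v i ≡ false) →
      ∀ {k} → Saves G S k → Saves G T k
    go m S le T⊆S isolated saves with missing? S T
    ... | no none = Saves-cong (none⇒⊆ none) T⊆S saves
    go zero    S le T⊆S isolated saves | yes (v , v∈S , v∉T) =
      Saves-cong (⊆-∣∣ T⊆S (≤-trans le (≤-reflexive (+-identityʳ _)))) T⊆S saves
    go (suc m) S le T⊆S isolated {k} (s , r , s+k≤) | yes (v , v∈S , v∉T)
      with s′ , refl , r′ ← minrank-isolated G v v∈S
                              (λ i p → remove-⊆ S v i p , remove-≢ S {v} p)
                              (λ i p v≢i → ∈-remove S {v} v≢i p) (isolated v v∈S v∉T) r =
      go m S′ (s≤s⁻¹ (≤-trans (≤-reflexive (∣∣-remove S v∈S)) (≤-trans le (≤-reflexive (+-suc ∣ T ∣ m)))))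
        (λ i i∈T → ∈-remove S {v} (λ { refl → true≢false i∈T v∉T }) (T⊆S i i∈T))
        (λ x p x∉T i q → isolated x (remove-⊆ S v x p) x∉T i (remove-⊆ S v i q))
        (s′ , r′ , s≤s⁻¹ (≤-trans s+k≤ (≤-reflexive (sym (∣∣-remove S v∈S)))))
      where
      S′ : Mask n
      S′ = S [ v ≔ false ]

  -- The head of the crown is the set of vertices that M sends into C; by
  -- `closed` it contains all neighbours of C.
  record Crown (S : Mask n) (M : Mate n) (C : Mask n) : Set where
    field
      ⊆S          : C ⊆ S
      nonempty    : ∃[ c ] c ∈ C
      independent : ∀ c d → c ∈ C → d ∈ C → adj c d ≡ false
      matched     : ∀ {h c} → M h ≡ just c → c ∈ C → h ∈ S × adj c h ≡ true
      injective   : ∀ {g h c} → M g ≡ just c → M h ≡ just c → g ≡ h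
      closed      : ∀ c h → c ∈ C → h ∈ S → adj c h ≡ true → ∃[ d ] M h ≡ just d × d ∈ C

  module _ {S M C} (crown : Crown S M C) where
    open Crown crown

    private
      H S′ : Mask n
      H  = partners adj M C
      S′ = λ i → if C i then false else if H i then false else S i

      ∈H⁻ : ∀ h → h ∈ H → ∃[ c ] M h ≡ just c × c ∈ C
      ∈H⁻ h h∈H with M h
      ... | just c = c , refl , h∈H

      ∈H⁺ : ∀ {h c} → M h ≡ just c → c ∈ C → h ∈ H
      ∈H⁺ eq c∈C rewrite eq = c∈C

      H⊆S : H ⊆ S
      H⊆S h h∈H = let (c , eq , c∈C) = ∈H⁻ h h∈H in proj₁ (matched eq c∈C)

      H∩C : ∀ h → h ∈ H → C h ≡ false
      H∩C h h∈H = let (c , eq , c∈C) = ∈H⁻ h h∈H in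
        Bool.¬-not (λ h∈C → true≢false (proj₂ (matched eq c∈C)) (independent c h c∈C h∈C))

      S′⊆S∖H : S′ ⊆ S ∖ H
      S′⊆S∖H i p = proj₁ (∈-∖⁻ (S ∖ H) C p)

    crown-< : ∣ S′ ∣ < ∣ S ∣
    crown-< = let (c , c∈C) = nonempty in
      ∣∣-strict (λ i p → proj₁ (∈-∖⁻ S H (S′⊆S∖H i p))) c (⊆S c c∈C) (∉-∖⁺ (S ∖ H) C c∈C)

    -- Forwards, deleting the head H makes C isolated by `closed`, and C is then deleted free of
    -- charge. Backwards, H is reinserted along its matching into C, each edge saving one, and the
    -- rest of C vertex by vertex.
    crown-⇔ : ∀ k → Saves G S k ⇔ Saves G S′ (k minus H)
    crown-⇔ k rewrite minus-∣∣ k H = mk⇔ to from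
      where
      to : Saves G S k → Saves G S′ (k ∸ ∣ H ∣)
      to saves = Saves-removeIsolated S′⊆S∖H isolated (Saves-remove H H⊆S saves)
        where
        isolated : ∀ v → v ∈ S ∖ H → S′ v ≡ false → ∀ i → i ∈ S ∖ H → adj v i ≡ false
        isolated v p q i r = Bool.¬-not λ e →
          let v∈C = ∈C
              (i∈S , i∉H) = ∈-∖⁻ S H r
              (d , eq , d∈C) = closed v i v∈C i∈S e
          in true≢false (∈H⁺ eq d∈C) i∉H
          where
          ∈C : v ∈ C
          ∈C with C v in eq
          ... | true  = refl
          ... | false = true≢false p q
      from : Saves G S′ (k ∸ ∣ H ∣) → Saves G S k
      -- The difference is truncated, so putting ∣ H ∣ back yields at least k and possibly more.
      from saves = Saves-weaken (≤-trans (m≤n+m∸n k ∣ H ∣) (≤-reflexive (+-comm ∣ H ∣ _)))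
        (Saves-matching H (λ h c → M h ≡ just c) (λ i p → proj₁ (∈-∖⁻ S H (S′⊆S∖H i p)))
          mates injective saves)
        where
        mates : ∀ h → h ∈ H → h ∈ S × S′ h ≡ false ×
          ∃[ c ] M h ≡ just c × c ∈ S × S′ c ≡ false × H c ≡ false × adj h c ≡ true
        mates h h∈H with c , eq , c∈C ← ∈H⁻ h h∈H = H⊆S h h∈H ,
          Bool.¬-not (λ p → true≢false h∈H (proj₂ (∈-∖⁻ S H (S′⊆S∖H h p)))) ,
          c , eq , ⊆S c c∈C , ∉-∖⁺ (S ∖ H) C c∈C ,
          Bool.¬-not (λ c∈H → true≢false c∈C (H∩C c c∈H)) ,
          trans (adj-sym h c) (proj₂ (matched eq c∈C))

-- Invariants and stabilisation of folds

just≢nothing : ∀ {a b} {A : Set a} {X : Set b} {m : Maybe A} {x} → m ≡ just x → m ≡ nothing → X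
just≢nothing refl ()

foldFin-each : ∀ {a p q} {A : Set a} (Φ : A → Set p) {n} (X : Fin n → A → Set q)
  (f : Fin n → A → A) z → Φ z →
  (∀ i x → Φ x → Φ (f i x) × X i (f i x) × (∀ j → X j x → X j (f i x))) →
  Φ (foldFin n f z) × ∀ i → X i (foldFin n f z)
foldFin-each Φ {zero}  X f z base step = base , λ ()
foldFin-each Φ {suc n} X f z base step =
  let (φ , each) = foldFin-each Φ (X ∘ suc) (λ i → f (suc i)) z base
        (λ i x φ → let (φ′ , now , keep) = step (suc i) x φ in φ′ , now , λ j → keep (suc j))
      (φ′ , now , keep) = step zero _ φ
  in φ′ , λ { zero → now ; (suc i) → keep (suc i) (each i) }

foldFin-each₂ : ∀ {a p q} {A : Set a} (Φ : A → Set p) {n} (X : Fin n → Fin n → A → Set q)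
  (f : Fin n → Fin n → A → A) z → Φ z →
  (∀ i j x → Φ x → Φ (f i j x) × X i j (f i j x) × (∀ k l → X k l x → X k l (f i j x))) →
  Φ (foldFin n (λ i x → foldFin n (λ j → f i j) x) z) ×
  ∀ i j → X i j (foldFin n (λ i x → foldFin n (λ j → f i j) x) z)
foldFin-each₂ Φ {n} X f z base step = foldFin-each Φ (λ i x → ∀ j → X i j x) _ z base
  λ i x φ →
    let ((φ′ , keep) , each) = foldFin-each
          -- The inner fold also remembers that whatever held at its start still holds, as
          -- preservation in the outer fold requires.
          (λ y → Φ y × ∀ k l → X k l x → X k l y) (X i) (f i) x (φ , λ _ _ → id)
          (λ j y (φ , old) → let (φ′ , now , keep) = step i j y φ in
             (φ′ , λ k l → keep k l ∘ old k l) , now , keep i)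
    in φ′ , each , λ k h l → keep k l (h l)

foldFin-fixed : ∀ {a} {A : Set a} n (f : Fin n → A → A) z → (∀ i → f i z ≡ z) → foldFin n f z ≡ z
foldFin-fixed zero    f z h = refl
foldFin-fixed (suc n) f z h = trans (cong (f zero) (foldFin-fixed n _ z (λ i → h (suc i)))) (h zero)

-- Closed states are fixed, so once closed the state stays so. Until then every round lowers μ,
-- which leaves room for at most `μ z` rounds.
foldFin-stabilises : ∀ {a p q} {A : Set a} (Φ : A → Set p) (Closed : A → Set q) (μ : A → ℕ)
  (f : A → A) →
  (∀ x → Φ x → Φ (f x)) → (∀ x → Closed x → f x ≡ x) →
  (∀ x → Φ x → Closed (f x) ⊎ μ (f x) < μ x) →
  ∀ n z → Φ z → μ z < n → Closed (foldFin n (λ _ → f) z)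
foldFin-stabilises Φ Closed μ f inv fixed step n z φ lt with progress n
  where
  φs : ∀ m → Φ (foldFin m (λ _ → f) z)
  φs m = foldFin-inv Φ m (λ _ → f) z φ (λ _ x → inv x)
  progress : ∀ m → Closed (foldFin m (λ _ → f) z) ⊎ μ (foldFin m (λ _ → f) z) + m ≤ μ z
  progress zero    = inj₂ (≤-reflexive (+-identityʳ _))
  progress (suc m) with progress m
  ... | inj₁ closed = inj₁ (subst Closed (sym (fixed _ closed)) closed)
  ... | inj₂ le with step _ (φs m)
  ...   | inj₁ closed = inj₁ closed
  ...   | inj₂ drops  = inj₂ (≤-trans (≤-reflexive (+-suc _ m)) (≤-trans (+-monoˡ-≤ m drops) le))
... | inj₁ closed = closed
... | inj₂ le     = ⊥-elim (<⇒≱ lt (≤-trans (m≤n+m n _) le))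

-- Augmenting paths

module Augmentation {n : ℕ} (A : Relation n) (S : Mask n) where

  Covers : Mate n → Fin n → Set
  Covers M c = ∃[ h ] M h ≡ just c

  Injective : Mate n → Set
  Injective M = ∀ {g h c} → M g ≡ just c → M h ≡ just c → g ≡ h

  Matching : (Fin n → Set) → Mate n → Set
  Matching V M = ∀ {h c} → M h ≡ just c → V c × A c h ≡ true × h ∈ S

  module Searching (V : Fin n → Set) (M : Mate n) (u : Fin n) (Vu : V u)
    (M-matching : Matching V M) (M-injective : Injective M) (M-exposed : ∀ h → M h ≢ just u) where

    ToCover : Fin n → Set
    ToCover d = d ≡ u ⊎ Covers M d

    record Augmented (N : Mate n) : Set where
      field
        matching  : Matching V N
        injective : Injective N
        covers    : ∀ d → ToCover d → Covers N d

    record Switched (c : Fin n) (N : Mate n) : Set where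
      field
        allowed   : V c
        matching  : Matching V N
        injective : Injective N
        exposed   : ∀ h → N h ≢ just c
        covers    : ∀ d → c ≢ d → ToCover d → Covers N d
        -- Switching takes up no new vertex h, so what is free in `M` is free in `N` and an
        -- augmentation there displaces nobody.
        domain    : ∀ h → M h ≡ nothing → N h ≡ nothing

    -- A switched matching agrees with M around every vertex not yet reached.
    record Invariant (s : Search A) : Set where
      field
        switched  : ∀ c N → proj₁ s c ≡ just N → Switched c N
        untouched : ∀ c N → proj₁ s c ≡ just N →
                    ∀ d h → proj₁ s d ≡ nothing → M h ≡ just d → N h ≡ just d
        augmented : ∀ N → proj₂ s ≡ just N → Augmented N
        root      : ∃[ N ] proj₁ s u ≡ just N

    module _ {c h N} (N-switched : Switched c N) (ch : A c h ≡ true) (h∈S : h ∈ S) where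
      open Switched N-switched using () renaming
        (allowed to Vc; matching to N-matching; injective to N-injective; exposed to N-exposed;
         covers to N-covers; domain to N-domain)

      private
        N′ : Mate n
        N′ = N [ h ≔ just c ]

        N′h : N′ h ≡ just c
        N′h = update-same N h (just c)

        lookup-N′ : ∀ {g e} → N′ g ≡ just e → (h ≡ g × c ≡ e) ⊎ (h ≢ g × N g ≡ just e)
        lookup-N′ {g} eq with h ≟ g
        ... | yes h≡g = inj₁ (h≡g , just-injective eq)
        ... | no  h≢g = inj₂ (h≢g , eq)

        matching′ : Matching V N′
        matching′ eq with lookup-N′ eq
        ... | inj₁ (refl , refl) = Vc , ch , h∈S
        ... | inj₂ (_ , eq′)     = N-matching eq′

        injective′ : Injective N′
        injective′ p q with lookup-N′ p | lookup-N′ q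
        ... | inj₁ (refl , refl) | inj₁ (refl , _)    = refl
        ... | inj₁ (refl , refl) | inj₂ (_ , q′)      = ⊥-elim (N-exposed _ q′)
        ... | inj₂ (_ , p′)      | inj₁ (refl , refl) = ⊥-elim (N-exposed _ p′)
        ... | inj₂ (_ , p′)      | inj₂ (_ , q′)      = N-injective p′ q′

        covers′ : ∀ d → (∀ {g} → N g ≡ just d → h ≢ g) → ToCover d → Covers N′ d
        covers′ d ≢h t with c ≟ d
        ... | yes refl = h , N′h
        ... | no c≢d   = let (g , eq) = N-covers d c≢d t in
          g , trans (update-other N {h} (just c) (≢h eq)) eq

      augment-switched : M h ≡ nothing → Augmented N′
      augment-switched free = record
        { matching  = matching′
        ; injective = injective′
        ; covers    = λ d → covers′ d (λ { eq refl → just≢nothing eq (N-domain h free) })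
        }

      -- The vertex `h` passes from `d` to `c`. As `N` is injective, `h` was the only cover of `d`,
      -- which is now exposed.
      switch-further : ∀ {d} → M h ≡ just d → N h ≡ just d → c ≢ d → Switched d N′
      switch-further {d} Mh Nh c≢d = record
        { allowed   = proj₁ (M-matching Mh)
        ; matching  = matching′
        ; injective = injective′
        ; exposed   = λ g eq → [ (λ (_ , c≡d) → c≢d c≡d) , (λ (h≢g , eq′) → h≢g (N-injective Nh eq′)) ]′ (lookup-N′ eq)
        ; covers    = λ e d≢e → covers′ e (λ { eq refl → d≢e (just-injective (trans (sym Nh) eq)) })
        ; domain    = λ g free → trans (update-other N {h} (just c) (λ { refl → just≢nothing Mh free })) (N-domain g free)
        }

    Found : Search A → Set
    Found s = ∃[ N ] proj₂ s ≡ just N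

    -- `C` will be the set reached when a round begins: vertices reached during the round may have
    -- to wait for the next one.
    Good : Mask n → Fin n → Fin n → Search A → Set
    Good C c h s = Found s ⊎
      (c ∈ C → A c h ≡ true → h ∈ S → ∃[ d ] M h ≡ just d × d ∈ reached A s)

    private
      ∈reached : ∀ s {d N} → proj₁ s d ≡ just N → d ∈ reached A s
      ∈reached s eq rewrite eq = refl

      reached⁻ : ∀ s {d} → d ∈ reached A s → ∃[ N ] proj₁ s d ≡ just N
      reached⁻ s {d} p with proj₁ s d
      ... | just N = N , refl

    record Extended (c h : Fin n) (s s′ : Search A) : Set where
      constructor extended
      field
        invariant : Invariant s′
        mono      : reached A s ⊆ reached A s′
        found     : Found s → Found s′
        good      : Good (reached A s) c h s′

    extend-spec : ∀ c h s → Invariant s → Extended c h s (extend A S M c h s)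
    extend-spec c h s inv with proj₂ s in found
    ... | just N = extended inv (λ _ → id) id (inj₁ (N , found))
    ... | nothing with proj₁ s c in Rc
    ...   | nothing = extended inv (λ _ → id) id
            (inj₂ (λ c∈ → just≢nothing (proj₂ (reached⁻ s c∈)) Rc))
    ...   | just N with A c h in ch
    ...     | false = extended inv (λ _ → id) id (inj₂ (λ _ ch′ → true≢false ch′ ch))
    ...     | true with S h in h∈S
    ...       | false = extended inv (λ _ → id) id (inj₂ (λ _ _ p → true≢false p h∈S))
    ...       | true with M h in Mh
    ...         | nothing = extended (record
                    { switched  = Invariant.switched inv
                    ; untouched = Invariant.untouched inv
                    ; augmented = λ { _ refl → augment-switched (Invariant.switched inv c N Rc) ch h∈S Mh }
                    ; root      = Invariant.root inv
                    }) (λ _ → id) (λ _ → _ , refl) (inj₁ (_ , refl))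
    ...         | just d with proj₁ s d in Rd
    ...           | just _  = extended inv (λ _ → id) id (inj₂ (λ _ _ _ → d , Mh , ∈reached s Rd))
    ...           | nothing = extended inv′ mono (λ p → ⊥-elim (just≢nothing (proj₂ p) found))
                      (inj₂ (λ _ _ _ → d , Mh , ∈reached s′ (update-same (proj₁ s) d (just N′))))
      where
      N′ : Mate n
      N′ = N [ h ≔ just c ]
      s′ : Search A
      s′ = proj₁ s [ d ≔ just N′ ] , nothing
      c≢d : c ≢ d
      c≢d refl = just≢nothing Rc Rd
      Nh : N h ≡ just d
      Nh = Invariant.untouched inv c N Rc d h Rd Mh
      lookup-R : ∀ e {K} → (proj₁ s [ d ≔ just N′ ]) e ≡ just K → (d ≡ e × N′ ≡ K) ⊎ proj₁ s e ≡ just K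
      lookup-R e eq with d ≟ e
      ... | yes d≡e = inj₁ (d≡e , just-injective eq)
      ... | no _    = inj₂ eq
      unreached : ∀ e → (proj₁ s [ d ≔ just N′ ]) e ≡ nothing → d ≢ e × proj₁ s e ≡ nothing
      unreached e eq with d ≟ e
      ... | no d≢e = d≢e , eq
      mono : reached A s ⊆ reached A s′
      mono e p with d ≟ e
      ... | yes _ = refl
      ... | no _  = p
      inv′ : Invariant s′
      inv′ = record
        { switched  = λ e K eq → [ (λ { (refl , refl) →
            switch-further (Invariant.switched inv c N Rc) ch h∈S Mh Nh c≢d }) ,
            Invariant.switched inv e K ]′ (lookup-R e eq)
        ; untouched = λ e K eq f g Rf Mg → let (d≢f , Rf′) = unreached f Rf in
            [ (λ { (refl , refl) → trans
                (update-other N {h} (just c) (λ { refl → d≢f (just-injective (trans (sym Mh) Mg)) }))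
                (Invariant.untouched inv c N Rc f g Rf′ Mg) }) ,
              (λ eq′ → Invariant.untouched inv e K eq′ f g Rf′ Mg) ]′ (lookup-R e eq)
        ; augmented = λ _ ()
        ; root      = reached⁻ s′ (mono u (∈reached s (proj₂ (Invariant.root inv))))
        }

    Closed : Search A → Set
    Closed s = Found s ⊎ ∀ c h → c ∈ reached A s → A c h ≡ true → h ∈ S →
                         ∃[ d ] M h ≡ just d × d ∈ reached A s

    extend-closed : ∀ c h s → Closed s → extend A S M c h s ≡ s
    extend-closed c h s (inj₁ (N , found)) rewrite found = refl
    extend-closed c h s (inj₂ closed) with proj₂ s
    ... | just _  = refl
    ... | nothing with proj₁ s c in Rc
    ...   | nothing = refl
    ...   | just N with A c h in ch
    ...     | false = refl
    ...     | true with S h in h∈S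
    ...       | false = refl
    ...       | true with d , Mh , d∈ ← closed c h (∈reached s Rc) ch h∈S
                     with _ , Rd ← reached⁻ s d∈ rewrite Mh | Rd = refl

    unreached : Search A → Mask n
    unreached s c = maybe′ (λ _ → false) true (proj₁ s c)

    private
      reached⇔ : ∀ s c → c ∈ reached A s → unreached s c ≡ false
      reached⇔ s c p with proj₁ s c
      ... | just _ = refl

      unreached⇔ : ∀ s c → unreached s c ≡ false → c ∈ reached A s
      unreached⇔ s c p with proj₁ s c
      ... | just _ = refl

      antitone : ∀ s t → reached A s ⊆ reached A t → unreached t ⊆ unreached s
      antitone s t sub c p with unreached s c in eq
      ... | true  = refl
      ... | false = true≢false p (reached⇔ t c (sub c (unreached⇔ s c eq)))

      antitone⁻ : ∀ s t → unreached t ⊆ unreached s → reached A s ⊆ reached A t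
      antitone⁻ s t sub c p with unreached t c in eq
      ... | false = unreached⇔ t c eq
      ... | true  = true≢false (sub c eq) (reached⇔ s c p)

    -- A round that neither augments nor reaches a new vertex has examined all edges at the reached
    -- vertices, so `Good` for all pairs becomes closedness.
    extendAll-spec : ∀ s → Invariant s → let s′ = extendAll A S M s in
      Invariant s′ × (Closed s′ ⊎ ∣ unreached s′ ∣ < ∣ unreached s ∣)
    extendAll-spec s inv = inv′ , progress
      where
      s′ = extendAll A S M s
      result : (Invariant s′ × reached A s ⊆ reached A s′) × ∀ c h → Good (reached A s) c h s′
      result = foldFin-each₂ (λ x → Invariant x × reached A s ⊆ reached A x) (Good (reached A s))
        (extend A S M) s (inv , λ _ → id)
        λ c h x (inv , sub) → let extended inv′ sub′ keep good = extend-spec c h x inv in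
          (inv′ , λ i → sub′ i ∘ sub i) ,
          [ inj₁ , (λ g → inj₂ (λ p → g (sub c p))) ]′ good ,
          λ k l → [ inj₁ ∘ keep , (λ g → inj₂ (λ p q r → let (d , eq , d∈) = g p q r in d , eq , sub′ d d∈)) ]′
      inv′ = proj₁ (proj₁ result)
      sub  = proj₂ (proj₁ result)
      progress : Closed s′ ⊎ ∣ unreached s′ ∣ < ∣ unreached s ∣
      progress with ∣ unreached s ∣ ≤? ∣ unreached s′ ∣
      ... | no  lt = inj₂ (≰⇒> lt)
      ... | yes le = inj₁ (closed (proj₂ s′) refl)
        where
        back : reached A s′ ⊆ reached A s
        back = antitone⁻ s′ s (⊆-∣∣ (antitone s s′ sub) le)
        closed : ∀ r → proj₂ s′ ≡ r → Closed s′
        closed (just N) eq = inj₁ (N , eq)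
        closed nothing  eq = inj₂ λ c h c∈ → [ (λ (_ , found) → just≢nothing found eq) , (λ g → g (back c c∈)) ]′
          (proj₂ result c h)

    private
      start : Search A
      start = (λ _ → nothing) [ u ≔ just M ] , nothing

      start-lookup : ∀ c {N} → proj₁ start c ≡ just N → u ≡ c × M ≡ N
      start-lookup c eq with u ≟ c
      ... | yes u≡c = u≡c , just-injective eq

      start-invariant : Invariant start
      start-invariant = record
        { switched  = λ c N eq → case start-lookup c eq of λ { (refl , refl) → record
            { allowed = Vu ; matching = M-matching ; injective = M-injective ; exposed = M-exposed
            ; covers = λ d u≢d → [ (λ d≡u → ⊥-elim (u≢d (sym d≡u))) , id ]′ ; domain = λ _ → id } }
        ; untouched = λ c N eq d h _ Mh → case start-lookup c eq of λ { (refl , refl) → Mh }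
        ; augmented = λ _ ()
        ; root      = M , update-same (λ _ → nothing) u (just M)
        }

      -- The root is reached from the beginning; this is why n rounds of the search suffice.
      start-measure : ∣ unreached start ∣ < n
      start-measure = ≤-trans (∣∣-strict {T = full} (λ _ _ → refl) u refl
        (reached⇔ start u (∈reached start (proj₂ (Invariant.root start-invariant)))))
        (∣∣≤n full)

    result : Search A
    result = search A S M u

    result-invariant : Invariant result
    result-invariant = foldFin-inv Invariant n (λ _ → extendAll A S M) start start-invariant
      (λ _ s inv → proj₁ (extendAll-spec s inv))

    result-closed : Closed result
    result-closed = foldFin-stabilises Invariant Closed (λ s → ∣ unreached s ∣) (extendAll A S M)
      (λ s inv → proj₁ (extendAll-spec s inv))
      (λ s closed → foldFin-fixed n _ s (λ c → foldFin-fixed n _ s (λ h → extend-closed c h s closed)))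
      (λ s inv → proj₂ (extendAll-spec s inv))
      n start start-invariant start-measure

    root-reached : u ∈ reached A result
    root-reached = ∈reached result (proj₂ (Invariant.root result-invariant))

    reached-allowed : ∀ c → c ∈ reached A result → V c
    reached-allowed c c∈ = let (N , eq) = reached⁻ result c∈ in
      Switched.allowed (Invariant.switched result-invariant c N eq)

-- Covering the independent set vertex by vertex

module Assigning {n : ℕ} (A : Relation n) (S I : Mask n) where

  open Augmentation A S

  -- The fold descends, so at stage p these are, the name notwithstanding, the vertices of I whose
  -- turn has already come. A successful stage covers all of them and no others.
  Unprocessed : ℕ → Fin n → Set
  Unprocessed p c = c ∈ I × p ≤ toℕ c

  record Failed (M : Mate n) (C : Mask n) : Set where
    field
      matching  : Matching (_∈ I) M
      injective : Injective M
      C⊆I       : C ⊆ I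
      nonempty  : ∃[ c ] c ∈ C
      closed    : ∀ c h → c ∈ C → A c h ≡ true → h ∈ S → ∃[ d ] M h ≡ just d × d ∈ C

  data Assigned (p : ℕ) : Mate n × Maybe (Mask n) → Set where
    assigned : ∀ {M} → Matching (Unprocessed p) M → Injective M →
               (∀ c → Unprocessed p c → Covers M c) → Assigned p (M , nothing)
    failed   : ∀ {M C} → Failed M C → Assigned p (M , just C)

  private
    weaken : ∀ {p M} → Matching (Unprocessed (suc p)) M → Matching (Unprocessed p) M
    weaken matching eq = let ((c∈I , p<c) , rest) = matching eq in (c∈I , <⇒≤ p<c) , rest

    later : ∀ {u c} → Unprocessed (toℕ u) c → c ≢ u → Unprocessed (suc (toℕ u)) c
    later (c∈I , u≤c) c≢u = c∈I , ≤∧≢⇒< u≤c (λ eq → c≢u (sym (toℕ-injective eq)))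

  -- M covers only vertices of larger index, hence leaves u exposed as the search demands. Success
  -- adds u to the covered vertices; failure leaves a closed set containing u.
  augment-search : ∀ {M} u → u ∈ I → Matching (Unprocessed (suc (toℕ u))) M → Injective M →
    (∀ c → Unprocessed (suc (toℕ u)) c → Covers M c) →
    Assigned (toℕ u) (maybe′ (λ N → N , nothing) (M , just (reached A (search A S M u)))
                             (proj₂ (search A S M u)))
  augment-search {M} u u∈I matching injective covers with proj₂ (search A S M u) in eq
  ... | just N = assigned (R.Augmented.matching augmented) (R.Augmented.injective augmented) covers′
    where
    module R = Searching (Unprocessed (toℕ u)) M u (u∈I , ≤-refl) (weaken matching) injective
                 (λ h eq → 1+n≰n (proj₂ (proj₁ (matching eq))))
    augmented = R.Invariant.augmented R.result-invariant N eq
    covers′ : ∀ c → Unprocessed (toℕ u) c → Covers N c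
    covers′ c un with c ≟ u
    ... | yes c≡u = R.Augmented.covers augmented c (inj₁ c≡u)
    ... | no  c≢u = R.Augmented.covers augmented c (inj₂ (covers c (later un c≢u)))
  ... | nothing = failed record
    { matching  = λ eq → let ((c∈I , _) , rest) = matching eq in c∈I , rest
    ; injective = injective
    ; C⊆I       = λ c c∈ → proj₁ (R.reached-allowed c c∈)
    ; nonempty  = u , R.root-reached
    ; closed    = [ (λ (_ , found) → just≢nothing found eq) , id ]′ R.result-closed
    }
    where
    module R = Searching (Unprocessed (toℕ u)) M u (u∈I , ≤-refl) (weaken matching) injective
                 (λ h eq → 1+n≰n (proj₂ (proj₁ (matching eq))))

  augment-spec : ∀ u s → Assigned (suc (toℕ u)) s → Assigned (toℕ u) (augment A S I u s)
  augment-spec u _ (failed f) = failed f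
  augment-spec u (M , nothing) (assigned matching injective covers) with I u in Iu
  ... | true  = augment-search u Iu matching injective covers
  ... | false = assigned (weaken matching) injective
    (λ c un → covers c (later un (λ { refl → true≢false (proj₁ un) Iu })))

  assign-spec : Assigned 0 (assign A S I)
  assign-spec = foldFin-ind Assigned n (augment A S I) _
    (assigned (λ ()) (λ ()) (λ c (_ , n≤c) → ⊥-elim (<⇒≱ (toℕ<n c) n≤c))) augment-spec

-- Correctness of the kernelization

module Correctness {c ℓ} (F : Field c ℓ) (G : Graph) where

  open LinearAlgebra F
  open Savings F G
  open Graph G using (adj; irrefl) renaming (order to n; sym to adj-sym)

  data MatchStep (i j : Fin n) (s : Mask n × ℕ) : Mask n × ℕ → Set where
    skipped : (i ∈ proj₁ s → j ∈ proj₁ s → adj i j ≡ false) → MatchStep i j s s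
    paired  : i ∈ proj₁ s → j ∈ proj₁ s → adj i j ≡ true →
              MatchStep i j s (proj₁ s [ i ≔ false ] [ j ≔ false ] , pred (proj₂ s))

  matchPair-step : ∀ i j s → MatchStep i j s (matchPair adj i j s)
  matchPair-step i j s with proj₁ s i in i∈
  ... | false = skipped (λ p _ → true≢false p i∈)
  ... | true with proj₁ s j in j∈
  ...   | false = skipped (λ _ p → true≢false p j∈)
  ...   | true with adj i j in ij
  ...     | true  = paired i∈ j∈ ij
  ...     | false = skipped (λ _ _ → ij)

  module _ (S : Mask n) (k : ℕ) where

    -- m counts the pairs matched so far; their ends are the vertices of S that
    -- are no longer in the mask.
    record GreedyInvariant (s : Mask n × ℕ) : Set (c ⊔ ℓ) where
      field
        m       : ℕ
        k∸m     : proj₂ s ≡ k ∸ m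
        ⊆S      : proj₁ s ⊆ S
        minrank : MinrankAtMost G (S ∖ proj₁ s) m
        count   : ∣ S ∣ ≡ ∣ proj₁ s ∣ + (m + m)

    greedy-step : ∀ {i j s s′} → MatchStep i j s s′ → GreedyInvariant s → GreedyInvariant s′
    greedy-step (skipped _) inv = inv
    greedy-step {i} {j} {J , l} (paired i∈J j∈J e) inv = record
      { m       = suc m
      ; k∸m     = trans (cong pred k∸m) (pred[m∸n]≡m∸[1+n] k m)
      ; ⊆S      = λ x p → ⊆S x (J′⊆J x p)
      ; minrank = minrank-pair (inj₂ e) cover minrank
      ; count   = trans count (trans (cong (_+ (m + m)) (sym (trans (cong suc
                    (∣∣-remove (J [ i ≔ false ]) (∈-remove J {i} (adj-≢ e) j∈J))) (∣∣-remove J i∈J))))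
                    (shift ∣ J′ ∣ m))
      }
      where
      open GreedyInvariant inv
      J′ : Mask n
      J′ = J [ i ≔ false ] [ j ≔ false ]
      J′⊆J : J′ ⊆ J
      J′⊆J x p = remove-⊆ J i x (remove-⊆ (J [ i ≔ false ]) j x p)
      shift : ∀ a m → suc (suc a) + (m + m) ≡ a + (suc m + suc m)
      shift = solve-∀
      cover : ∀ x → x ∈ S ∖ J′ → x ∈ S ∖ J ⊎ i ≡ x ⊎ j ≡ x
      cover x p = case i ≟ x of λ where
        (yes i≡x) → inj₂ (inj₁ i≡x)
        (no i≢x)  → case j ≟ x of λ where
          (yes j≡x) → inj₂ (inj₂ j≡x)
          (no j≢x)  → let (x∈S , x∉J′) = ∈-∖⁻ S J′ {x} p in inj₁ (∈-∖⁺ S J x∈S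
            (trans (sym (trans (update-other (J [ i ≔ false ]) {j} false j≢x) (update-other J {i} false i≢x))) x∉J′))

    matchStep-⊆ : ∀ {i j s s′} → MatchStep i j s s′ → proj₁ s′ ⊆ proj₁ s
    matchStep-⊆ (skipped _) x p = p
    matchStep-⊆ {i} {j} {J , l} (paired _ _ _) x p =
      remove-⊆ J i x (remove-⊆ (J [ i ≔ false ]) j x p)

    NonEdge : Fin n → Fin n → Mask n × ℕ → Set
    NonEdge i j s = i ∈ proj₁ s → j ∈ proj₁ s → adj i j ≡ false

    matchStep-nonEdge : ∀ {i j s s′} → MatchStep i j s s′ → NonEdge i j s′
    matchStep-nonEdge (skipped h) = h
    matchStep-nonEdge {i} {j} {J , l} (paired _ _ _) _ j∈J′ =
      true≢false j∈J′ (update-same (J [ i ≔ false ]) j false)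

    -- The mask only shrinks, so a pair that is no edge inside it when visited stays so; after all
    -- pairs the remaining mask is independent.
    greedy-spec : GreedyInvariant (greedy adj (S , k)) × ∀ i j → NonEdge i j (greedy adj (S , k))
    greedy-spec = foldFin-each₂ GreedyInvariant NonEdge (matchPair adj) (S , k)
      (record { m = 0 ; k∸m = refl ; ⊆S = λ _ → id
              ; minrank = minrank-empty G (λ i → none i) ; count = sym (+-identityʳ _) })
      λ i j s inv → let step = matchPair-step i j s in
        greedy-step step inv , matchStep-nonEdge step ,
        λ x y h x∈ y∈ → h (matchStep-⊆ step x x∈) (matchStep-⊆ step y y∈)
      where
      none : ∀ i → (S ∖ S) i ≡ false
      none i with S i
      ... | true  = refl
      ... | false = refl

  Unmatched : Mask n × ℕ → Mask n
  Unmatched s = proj₁ (greedy adj s)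

  Irreducible : Mask n × ℕ → Set
  Irreducible s = proj₂ (assign adj (proj₁ s) (Unmatched s)) ≡ nothing

  module _ (s : Mask n × ℕ) where
    private
      S = proj₁ s
      k = proj₂ s
      I = Unmatched s
    open GreedyInvariant (proj₁ (greedy-spec S k)) renaming (⊆S to I⊆S)

    I-independent : ∀ c d → c ∈ I → d ∈ I → adj c d ≡ false
    I-independent = proj₂ (greedy-spec S k)

    -- The 2m matched vertices have minrank at most m.
    Saves-greedy : Saves G S m
    Saves-greedy = Saves-grow (λ i p → proj₁ (∈-∖⁻ S I p))
      (m , minrank , ≤-reflexive (+-cancelˡ-≡ ∣ I ∣ _ _
        (trans (sym count) (trans (∣∣-∖ S I I⊆S) (+-comm _ ∣ I ∣)))))

    failed⇒crown : ∀ {M C} → Assigning.Failed adj S I M C → Crown S M C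
    failed⇒crown f = record
      { ⊆S          = λ c c∈C → I⊆S c (C⊆I c c∈C)
      ; nonempty    = nonempty
      ; independent = λ c d p q → I-independent c d (C⊆I c p) (C⊆I d q)
      ; matched     = λ eq _ → let (_ , e , h∈S) = matching eq in h∈S , e
      ; injective   = injective
      ; closed      = λ c h p q e → closed c h p e q
      }
      where open Assigning.Failed f

    reduce-cases : (Irreducible s × reduce adj s ≡ s) ⊎
      ∃[ M ] ∃[ C ] Crown S M C × reduce adj s ≡ removeCrown adj M C s
    reduce-cases with assign adj S I | Assigning.assign-spec adj S I
    ... | M , nothing | _                  = inj₁ (refl , refl)
    ... | M , just C  | Assigning.failed f = inj₂ (M , C , failed⇒crown f , refl)

    reduce-⇔ : Saves G S k ⇔ Saves G (proj₁ (reduce adj s)) (proj₂ (reduce adj s))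
    reduce-⇔ with reduce-cases
    ... | inj₁ (_ , eq)             rewrite eq = ⇔-refl
    ... | inj₂ (M , C , crown , eq) rewrite eq = crown-⇔ crown k

    reduce-progress : (Irreducible s × reduce adj s ≡ s) ⊎ ∣ proj₁ (reduce adj s) ∣ < ∣ S ∣
    reduce-progress with reduce-cases
    ... | inj₁ p                    = inj₁ p
    ... | inj₂ (M , C , crown , eq) rewrite eq = inj₂ (crown-< crown)

    -- No search failed, so all of I is covered. A partner of a vertex of I is adjacent to it and
    -- therefore lies outside the independent set I.
    irreducible⇒Saves : Irreducible s → Saves G S ∣ I ∣
    irreducible⇒Saves irr with assign adj S I | Assigning.assign-spec adj S I
    ... | M , nothing | Assigning.assigned matching injective covers =
      Saves-matching {T = ∅} I (λ c h → M h ≡ just c) (λ _ ())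
        (λ c c∈I → let (h , eq) = covers c (c∈I , z≤n)
                       (_ , e , h∈S) = matching eq in
          I⊆S c c∈I , refl , h , eq , h∈S , refl ,
          Bool.¬-not (λ h∈I → true≢false e (I-independent c h c∈I h∈I)) , e)
        (λ p q → just-injective (trans (sym p) q))
        Saves-∅

    Saves-emptyGraph : Saves emptyGraph full 0
    Saves-emptyGraph = 0 , minrank-empty emptyGraph (λ ()) , z≤n

    -- When a truncated difference is zero, the corresponding matching alone saves k and both sides
    -- hold.
    kernelOf-⇔ : Irreducible s →
      Saves G S k ⇔ Saves (proj₁ (kernelOf G s)) full (proj₂ (kernelOf G s))
    kernelOf-⇔ irr with proj₂ (greedy adj s) | k∸m | k minus I | minus-∣∣ k I
    ... | zero  | eq | _     | _  = mk⇔ (λ _ → Saves-emptyGraph)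
      (λ _ → Saves-weaken (m∸n≡0⇒m≤n {k} {m} (sym eq)) Saves-greedy)
    ... | suc _ | _  | zero  | eq = mk⇔ (λ _ → Saves-emptyGraph)
      (λ _ → Saves-weaken (m∸n≡0⇒m≤n {k} {∣ I ∣} (sym eq)) (irreducible⇒Saves irr))
    ... | suc _ | _  | suc _ | _  = ⇔-sym (Saves-induced G S k)

    kernelOf-size : Irreducible s → order (proj₁ (kernelOf G s)) ≤ 3 * (proj₂ (kernelOf G s) ∸ 1)
    kernelOf-size irr with proj₂ (greedy adj s) | k∸m | k minus I | minus-∣∣ k I
    ... | zero  | _  | _     | _   = z≤n
    ... | suc _ | _  | zero  | _   = z≤n
    ... | suc _ | eq | suc _ | eq′ = begin
      length (members S)    ≡⟨ length-members S ⟩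
      ∣ S ∣                 ≡⟨ count ⟩
      ∣ I ∣ + (m + m)       ≤⟨ +-mono-≤ (below ∣ I ∣ eq′) (+-mono-≤ (below m eq) (below m eq)) ⟩
      k ∸ 1 + (k ∸ 1 + (k ∸ 1)) ≡⟨ cong (λ x → k ∸ 1 + (k ∸ 1 + x)) (+-identityʳ (k ∸ 1)) ⟨
      3 * (k ∸ 1) ∎
      where
      open ≤-Reasoning
      below : ∀ x {l} → suc l ≡ k ∸ x → x ≤ k ∸ 1
      below x eq = ∸-monoˡ-≤ 1 (m∸n≢0⇒n<m {k} {x} (λ z → 1+n≢0 (trans eq z)))

  reduceAll-irreducible : ∀ k → Irreducible (reduceAll adj k)
  reduceAll-irreducible k = foldFin-stabilises (λ _ → ⊤) Irreducible (λ s → ∣ proj₁ s ∣) (reduce adj)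
    (λ _ _ → tt) fixed progress (suc n) (full , k) tt (s≤s (∣∣≤n full))
    where
    fixed : ∀ s → Irreducible s → reduce adj s ≡ s
    fixed s irr = cong (maybe′ _ s) irr
    progress : ∀ s → ⊤ → Irreducible (reduce adj s) ⊎ ∣ proj₁ (reduce adj s) ∣ < ∣ proj₁ s ∣
    progress s _ with reduce-progress s
    ... | inj₂ lt = inj₂ lt
    ... | inj₁ (irr , eq) = inj₁ (subst Irreducible (sym eq) irr)

  reduceAll-⇔ : ∀ k → Saves G full k ⇔ Saves G (proj₁ (reduceAll adj k)) (proj₂ (reduceAll adj k))
  reduceAll-⇔ k = foldFin-inv (λ s → Saves G full k ⇔ Saves G (proj₁ s) (proj₂ s)) (suc n)
    (λ _ → reduce adj) (full , k) ⇔-refl (λ _ s eq → ⇔-trans eq (reduce-⇔ s))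

  kernelization-⇔ : ExcludedMiddle (c ⊔ ℓ) → ∀ k →
    let (G′ , k′) = kernelization (G , k) in
    ParameterizedProblem.Yes (DualMinrank F) G k ⇔ ParameterizedProblem.Yes (DualMinrank F) G′ k′
  kernelization-⇔ em k = ⇔-trans (Yes⇔Saves em G k) (⇔-trans (reduceAll-⇔ k)
    (⇔-trans (kernelOf-⇔ (reduceAll adj k) (reduceAll-irreducible k)) (⇔-sym (Yes⇔Saves em (proj₁ (kernelization (G , k))) (proj₂ (kernelization (G , k)))))))

  kernelization-size : ∀ k → let (G′ , k′) = kernelization (G , k) in order G′ ≤ 3 * (k′ ∸ 1)
  kernelization-size k = kernelOf-size (reduceAll adj k) (reduceAll-irreducible k)

theorem1p3 : ∀ {c ℓ} → ExcludedMiddle (c ⊔ ℓ) → (F : Field c ℓ) →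
    Σ[ K ∈ Kernelization (DualMinrank F) ]
    (∀ (G : Graph) (k : ℕ) →
    let (G′ , k′) = Kernelization.kernel K (G , k) in
    + order G′ ℤ.≤ (+ 3 ℤ.* + k′ ℤ.- + 3) ℤ.⊔ + 0 × k′ ≤ k)
theorem1p3 em F = record
  { kernel         = kernelization
  ; polynomialTime = computed⇒polynomialTime F (withOrder (code `kernelize)) run-kernelization
  ; bound          = sizeBound
  ; computable     = sizeBound-computable
  ; bounded        = λ G k →
      ≤-trans (size-Graph (proj₁ (kernelization (G , k))))
        (graphSize-≤ {k = k} (≤-trans (Correctness.kernelization-size F G k)
          (*-monoʳ-≤ 3 (≤-trans (m∸n≤m (proj₂ (kernelization (G , k))) 1) (parameter-kernelization G k))))) ,
      ≤-trans (parameter-kernelization G k) (k≤sizeBound k)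
  ; equivalent     = λ G → Correctness.kernelization-⇔ F G em
  } , λ G k → ≤-integer (proj₂ (kernelization (G , k))) (Correctness.kernelization-size F G k) , parameter-kernelization G k
  where
  ≤-integer : ∀ {n} k → n ≤ 3 * (k ∸ 1) → + n ℤ.≤ (+ 3 ℤ.* + k ℤ.- + 3) ℤ.⊔ + 0
  -- Here 3k - 3 is -3 and the maximum is 0, as is the truncated bound.
  ≤-integer zero    le = ℤ.+≤+ le
  ≤-integer {n} (suc k) le = ℤ.≤-trans (ℤ.+≤+ le) (ℤ.≤-trans (ℤ.≤-reflexive eq) (ℤ.i≤i⊔j _ (+ 0)))
    where
    eq : + (3 * k) ≡ + 3 ℤ.* + suc k ℤ.- + 3
    eq = trans (cong (λ m → + (m ∸ 3)) (sym (*-suc 3 k))) (sym (ℤ.⊖-≥ {3 * suc k} {3} (m≤m*n 3 (suc k))))
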